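{- There exists a deterministic polynomial time algorithm which, given a finite ground set $\mathcal{N}$, value oracle access to a non-negative monotone submodular function $f\colon 2^{\mathcal{N}} \to \mathbb{R}_{\geq 0}$, and independence oracle access to a matroid $\mathcal{M} = (\mathcal{N}, \mathcal{I})$, outputs a set $I \in \mathcal{I}$ such that \[ f(I) \geq 0.5008 \cdot \max_{S \in \mathcal{I}} f(S) . \]
   Context: For $u \in \mathcal{N}$ and $S \subseteq \mathcal{N}$ write $f(u \mid S) = f(S \cup \{u\}) - f(S)$. A set function $f$ is monotone if $f(S) \leq f(T)$ for all $S \subseteq T \subseteq \mathcal{N}$, and submodular if $f(u \mid S) \geq f(u \mid T)$ for all $S \subseteq T \subseteq \mathcal{N}$ and $u \in \mathcal{N} \setminus T$. A value oracle for $f$ returns $f(S)$ for any queried $S \subseteq \mathcal{N}$. An independence oracle for $\mathcal{M}$ answers, for any queried $S \subseteq \mathcal{N}$, whether $S \in \mathcal{I}$. Polynomial time means that the number of oracle queries and of other operations is polynomial in $|\mathcal{N}|$. -}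

module Defs where

open import Algebra.Bundles using (CommutativeRing)
import Algebra.Definitions.RawMonoid as RawMonoid
open import Data.Bool.Base using (Bool; true; false; not; _∧_; if_then_else_)
open import Data.Fin.Base using (Fin; toℕ)
open import Data.Fin.Subset using (Subset; _∈_; _∉_; _⊆_; _∪_; ⁅_⁆; ⊥; ∣_∣)
open import Data.List.Base using (List; foldr)
open import Data.Nat.Base as ℕ using (ℕ; suc; _<_; _≡ᵇ_; _<ᵇ_; _≤ᵇ_)
open import Data.Product.Base using (Σ; ∃; _×_; _,_; proj₁)
open import Data.Vec.Base using (tabulate)
open import Level using (0ℓ)
open import Relation.Binary.PropositionalEquality using (_≡_)
open import Relation.Binary.Structures using (IsDecTotalOrder)
open import Relation.Nullary using (¬_; yes; no; does)
open import Relation.Unary using (Decidable)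

-- The real numbers, given by the axioms that characterise them up to
-- isomorphism: a Dedekind-complete totally ordered field.  They are the
-- classical reals: the order is decidable, as ℝ-valued computation with
-- branching on comparisons requires, so constructing an instance takes
-- excluded middle.
record RealNumbers : Set₁ where
  field
    commutativeRing : CommutativeRing 0ℓ 0ℓ

  open CommutativeRing commutativeRing public

  infix 4 _≤_
  field
    _≤_             : Carrier → Carrier → Set
    isDecTotalOrder : IsDecTotalOrder _≈_ _≤_
    0≉1             : ¬ (0# ≈ 1#)
    inverse         : ∀ x → ¬ (x ≈ 0#) → ∃ λ y → x * y ≈ 1#
    +-monoˡ-≤       : ∀ z {x y} → x ≤ y → x + z ≤ y + z
    *-nonNegative   : ∀ {x y} → 0# ≤ x → 0# ≤ y → 0# ≤ x * y

  UpperBound : (Carrier → Set) → Carrier → Set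
  UpperBound P b = ∀ x → P x → x ≤ b

  field
    supremum : ∀ (P : Carrier → Set) → ∃ P → ∃ (UpperBound P) →
               ∃ λ s → UpperBound P s × (∀ b → UpperBound P b → s ≤ b)

  open IsDecTotalOrder isDecTotalOrder public using (_≟_; _≤?_)

  fromℕ : ℕ → Carrier
  fromℕ k = k · 1#
    where open RawMonoid +-rawMonoid using () renaming (_×_ to _·_)

  -- Division by zero yields zero.
  infixl 7 _÷_
  _÷_ : Carrier → Carrier → Carrier
  x ÷ y with y ≟ 0#
  ... | yes _   = 0#
  ... | no  y≉0 = x * proj₁ (inverse y y≉0)

-- The ground set is Fin n.
record Matroid (n : ℕ) : Set₁ where
  field
    Independent   : Subset n → Set
    ∅-independent : Independent ⊥
    hereditary    : ∀ {S T} → S ⊆ T → Independent T → Independent S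
    augmentation  : ∀ {S T} → Independent S → Independent T → ∣ S ∣ < ∣ T ∣ →
                    ∃ λ u → u ∈ T × u ∉ S × Independent (S ∪ ⁅ u ⁆)

open Matroid public using (Independent)

module _ (ℝ : RealNumbers) where
  open RealNumbers ℝ

  SetFunction : ℕ → Set
  SetFunction n = Subset n → Carrier

module _ (ℝ : RealNumbers) {n : ℕ} (f : SetFunction ℝ n) where
  open RealNumbers ℝ

  marginal : Fin n → Subset n → Carrier
  marginal u S = f (S ∪ ⁅ u ⁆) - f S

  NonNegative : Set
  NonNegative = ∀ S → 0# ≤ f S

  Monotone : Set
  Monotone = ∀ {S T} → S ⊆ T → f S ≤ f T

  Submodular : Set
  Submodular = ∀ {S T} → S ⊆ T → ∀ u → u ∉ T → marginal u T ≤ marginal u S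

  IsMaximumOver : (Subset n → Set) → Carrier → Set
  IsMaximumOver P m = (∃ λ S → P S × f S ≈ m) × (∀ S → P S → f S ≤ m)

-- Algorithms are programs of a random access machine with two memories,
-- one for natural numbers and one for reals, each addressed by a row and a
-- column.  A program is one fixed finite text used for all inputs; the
-- instance is visible to it only through `size` (which is n) and the two
-- oracles.  A query names a row of the natural-number memory that holds the
-- characteristic vector of the queried set.
--
-- Every operation, a query included, has unit cost.  There is no
-- multiplication of natural numbers: it would allow exponentially long
-- integers after polynomially many steps.  Reals are operated on and compared
-- exactly, but cannot be rounded or converted to natural numbers.

infixl 6 _⊕_ _⊖_ _⊞_ _⊟_
infixl 7 _⊠_ _⊘_
infix  4 _≤ᴺ_ _≤ᴿ_
infixr 3 _and_
infix  2 N[_,_]≔_ R[_,_]≔_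
infixr 1 _︔_

data NatExp : Set where
  lit     : ℕ → NatExp
  size    : NatExp
  N[_,_]  : NatExp → NatExp → NatExp
  _⊕_ _⊖_ : NatExp → NatExp → NatExp

data RealExp : Set where
  lit             : ℕ → RealExp
  R[_,_]          : NatExp → NatExp → RealExp
  _⊞_ _⊟_ _⊠_ _⊘_ : RealExp → RealExp → RealExp
  value           : NatExp → RealExp

data Test : Set where
  _≤ᴺ_        : NatExp → NatExp → Test
  _≤ᴿ_        : RealExp → RealExp → Test
  independent : NatExp → Test
  neg         : Test → Test
  _and_       : Test → Test → Test

data Program : Set where
  skip         : Program
  N[_,_]≔_     : NatExp → NatExp → NatExp → Program
  R[_,_]≔_     : NatExp → NatExp → RealExp → Program
  _︔_          : Program → Program → Program
  cond         : Test → Program → Program → Program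
  while        : Test → Program → Program

costᴺ : NatExp → ℕ
costᴺ (lit _)    = 1
costᴺ size       = 1
costᴺ N[ a , i ] = suc (costᴺ a ℕ.+ costᴺ i)
costᴺ (d ⊕ e)    = suc (costᴺ d ℕ.+ costᴺ e)
costᴺ (d ⊖ e)    = suc (costᴺ d ℕ.+ costᴺ e)

costᴿ : RealExp → ℕ
costᴿ (lit _)    = 1
costᴿ R[ a , i ] = suc (costᴺ a ℕ.+ costᴺ i)
costᴿ (d ⊞ e)    = suc (costᴿ d ℕ.+ costᴿ e)
costᴿ (d ⊟ e)    = suc (costᴿ d ℕ.+ costᴿ e)
costᴿ (d ⊠ e)    = suc (costᴿ d ℕ.+ costᴿ e)
costᴿ (d ⊘ e)    = suc (costᴿ d ℕ.+ costᴿ e)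
costᴿ (value a)  = suc (costᴺ a)

costᵀ : Test → ℕ
costᵀ (d ≤ᴺ e)        = suc (costᴺ d ℕ.+ costᴺ e)
costᵀ (d ≤ᴿ e)        = suc (costᴿ d ℕ.+ costᴿ e)
costᵀ (independent a) = suc (costᴺ a)
costᵀ (neg b)         = suc (costᵀ b)
costᵀ (b and c)       = suc (costᵀ b ℕ.+ costᵀ c)

Memory : Set → Set
Memory A = ℕ → ℕ → A

write : {A : Set} → Memory A → ℕ → ℕ → A → Memory A
write m a i v a′ i′ = if (a′ ≡ᵇ a) ∧ (i′ ≡ᵇ i) then v else m a′ i′

-- Nonzero entries mark the elements of the set.
row : (n : ℕ) → Memory ℕ → ℕ → Subset n
row n m a = tabulate λ i → 0 <ᵇ m a (toℕ i)

module _ (ℝ : RealNumbers) where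
  open RealNumbers ℝ

  record State : Set where
    constructor ⟨_,_⟩
    field
      nats  : Memory ℕ
      reals : Memory Carrier

  initial : State
  initial = ⟨ (λ _ _ → 0) , (λ _ _ → 0#) ⟩

module Execution (ℝ : RealNumbers) {n : ℕ} (f : SetFunction ℝ n)
                 {Indep : Subset n → Set} (indep? : Decidable Indep) where
  open RealNumbers ℝ
  open State

  evalᴺ : State ℝ → NatExp → ℕ
  evalᴺ s (lit k)    = k
  evalᴺ s size       = n
  evalᴺ s N[ a , i ] = nats s (evalᴺ s a) (evalᴺ s i)
  evalᴺ s (d ⊕ e)    = evalᴺ s d ℕ.+ evalᴺ s e
  evalᴺ s (d ⊖ e)    = evalᴺ s d ℕ.∸ evalᴺ s e

  evalᴿ : State ℝ → RealExp → Carrier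
  evalᴿ s (lit k)    = fromℕ k
  evalᴿ s R[ a , i ] = reals s (evalᴺ s a) (evalᴺ s i)
  evalᴿ s (d ⊞ e)    = evalᴿ s d + evalᴿ s e
  evalᴿ s (d ⊟ e)    = evalᴿ s d - evalᴿ s e
  evalᴿ s (d ⊠ e)    = evalᴿ s d * evalᴿ s e
  evalᴿ s (d ⊘ e)    = evalᴿ s d ÷ evalᴿ s e
  evalᴿ s (value a)  = f (row n (nats s) (evalᴺ s a))

  evalᵀ : State ℝ → Test → Bool
  evalᵀ s (d ≤ᴺ e)        = evalᴺ s d ≤ᵇ evalᴺ s e
  evalᵀ s (d ≤ᴿ e)        = does (evalᴿ s d ≤? evalᴿ s e)
  evalᵀ s (independent a) = does (indep? (row n (nats s) (evalᴺ s a)))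
  evalᵀ s (neg b)         = not (evalᵀ s b)
  evalᵀ s (b and c)       = evalᵀ s b ∧ evalᵀ s c

  setᴺ : State ℝ → NatExp → NatExp → NatExp → State ℝ
  setᴺ s a i e =
    ⟨ write (nats s) (evalᴺ s a) (evalᴺ s i) (evalᴺ s e) , reals s ⟩

  setᴿ : State ℝ → NatExp → NatExp → RealExp → State ℝ
  setᴿ s a i e =
    ⟨ nats s , write (reals s) (evalᴺ s a) (evalᴺ s i) (evalᴿ s e) ⟩

  -- s ⊢ p ⇓[ t ] s′ : started in s, p halts in s′ at total cost t.
  infix 4 _⊢_⇓[_]_
  data _⊢_⇓[_]_ : State ℝ → Program → ℕ → State ℝ → Set where

    run-skip : ∀ {s} → s ⊢ skip ⇓[ 1 ] s

    run-setᴺ : ∀ {s a i e} →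
               s ⊢ N[ a , i ]≔ e ⇓[ suc (costᴺ a ℕ.+ costᴺ i ℕ.+ costᴺ e) ]
               setᴺ s a i e

    run-setᴿ : ∀ {s a i e} →
               s ⊢ R[ a , i ]≔ e ⇓[ suc (costᴺ a ℕ.+ costᴺ i ℕ.+ costᴿ e) ]
               setᴿ s a i e

    run-seq : ∀ {s s′ s″ p q t u} →
              s ⊢ p ⇓[ t ] s′ → s′ ⊢ q ⇓[ u ] s″ →
              s ⊢ p ︔ q ⇓[ t ℕ.+ u ] s″

    run-then : ∀ {s s′ b p q t} → evalᵀ s b ≡ true →
               s ⊢ p ⇓[ t ] s′ →
               s ⊢ cond b p q ⇓[ suc (costᵀ b ℕ.+ t) ] s′

    run-else : ∀ {s s′ b p q t} → evalᵀ s b ≡ false →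
               s ⊢ q ⇓[ t ] s′ →
               s ⊢ cond b p q ⇓[ suc (costᵀ b ℕ.+ t) ] s′

    run-stop : ∀ {s b p} → evalᵀ s b ≡ false →
               s ⊢ while b p ⇓[ suc (costᵀ b) ] s

    run-loop : ∀ {s s′ s″ b p t u} → evalᵀ s b ≡ true →
               s ⊢ p ⇓[ t ] s′ → s′ ⊢ while b p ⇓[ u ] s″ →
               s ⊢ while b p ⇓[ suc (costᵀ b ℕ.+ t ℕ.+ u) ] s″

  -- The output of a program is the set in row 0.
  _Outputs_InTime_ : Program → Subset n → ℕ → Set
  p Outputs I InTime t =
    Σ (State ℝ) λ s → initial ℝ ⊢ p ⇓[ t ] s × row n (nats s) 0 ≡ I

-- Coefficients, constant term first.
Polynomial : Set
Polynomial = List ℕ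

evalPoly : Polynomial → ℕ → ℕ
evalPoly cs n = foldr (λ c acc → c ℕ.+ n ℕ.* acc) 0 cs

{-# OPTIONS --safe #-}

-- Local search with a non-oblivious objective.  An independent set W is kept
-- as a disjoint union L ∪ R and the search maximises
-- g = 2 f(L) + 2 f(R) + 3 f(W).  For an optimal independent set T there is a
-- permutation h of the ground set such that W - h(u) + u is independent for
-- every u ∈ T.  Inserting u into L and into R in turn, in exchange for h(u),
-- and adding up the changes of g over u ∈ T gives, by submodularity,
--   Σ Δg ≥ 10 f(T) - 18 f(W),
-- so that f(W) ≥ 5/9 f(T) at a local optimum.  Since 5/9 exceeds 19/36, and
-- 19/36 exceeds 0.5008, as long as f(W) ≤ 19/36 f(T) the best of the at most
-- 2n moves raises g by at least f(T) / 4n.  As 0 ≤ g ≤ 7 f(T), this cannot go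
-- on for 28 n + 1 rounds, and the best W met in them is the output.
module Submission where

open import Defs
open import Data.Fin.Subset using (Subset)
open import Data.Nat.Base as ℕ using (ℕ)
open import Data.Product.Base using (∃; _×_)
open import Relation.Unary using (Decidable)

import Algebra.Properties.CommutativeMonoid.Mult as CommutativeMonoidMult
import Algebra.Properties.CommutativeMonoid.Sum as CommutativeMonoidSum
import Algebra.Properties.CommutativeSemigroup as CommutativeSemigroupProperties
import Algebra.Properties.Monoid.Mult as MonoidMult
import Algebra.Properties.Ring as RingProperties
import Algebra.Properties.Semiring.Mult as SemiringMult
open import Data.Bool.Base using (Bool; true; false; if_then_else_)
open import Data.Bool.Properties using (T-≡)
open import Data.Empty using () renaming (⊥ to Absurd)
open import Data.Fin.Base using (Fin; zero; suc; toℕ; fromℕ<)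
open import Data.Fin.Patterns
open import Data.Fin.Permutation using (Permutation′; _⟨$⟩ʳ_; _∘ₚ_; transpose) renaming (id to idₚ)
import Data.Fin.Properties as Fin
open import Data.Fin.Subset
  using (_∈_; _∉_; _⊆_; _∪_; _─_; ⁅_⁆; ⊥; ⊤; ∣_∣; inside; outside; Empty)
  renaming (_-_ to infixl 5 _∖_)
open import Data.Fin.Subset.Properties
open import Data.List.Base using (List; []; _∷_; length; map)
open import Data.Nat.Base using (zero; suc; _<_; _<ᵇ_; _≤ᵇ_; _≡ᵇ_)
import Data.Nat.Properties as ℕ
open import Data.Nat.Solver using (module +-*-Solver)
open import Data.Product.Base using (proj₁; proj₂; _,_)
open import Data.Sum.Base using (_⊎_; inj₁; inj₂; [_,_]′)
open import Data.Unit.Base using (tt) renaming (⊤ to Unit)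
open import Data.Vec.Base as Vec using (Vec; []; _∷_; here; there; lookup; _[_]≔_)
open import Data.Vec.Properties
  using (lookup∘tabulate; tabulate∘lookup; tabulate-cong; lookup∘update; lookup∘update′;
         lookup-replicate; lookup⇒[]=; []=⇒lookup)
open import Function.Base using (_∘_; id)
open import Function.Bundles using (Equivalence)
import Relation.Binary.Reasoning.Setoid as SetoidReasoning
open import Relation.Binary.PropositionalEquality as ≡ using (_≡_; _≢_; _≗_)
open import Relation.Binary.Structures using (IsDecTotalOrder)
open import Relation.Nullary using (¬_; Dec; yes; no; does; contradiction)
open import Relation.Nullary.Decidable using (_×-dec_; dec-true; dec-false; toWitness)

-- With f alone as objective the same exchange argument yields only f(T) - 2 f(W), hence 1/2.
-- Splitting W adds two complementary effects. If f(L) and f(R) are small, the gains f(T) - f(L) and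
-- f(T) - f(R) of insertion into the parts beat f(T) - f(W). If they are large, removals from W are
-- cheap: the sum of f(W) - f(W - v) over all v is at most 2 f(W) - f(L) - f(R). For weights a, a, b
-- the two moves per element add up to (2a + 2b) f(T) - 6b f(W) + (2b - 3a)(f(L) + f(R)), and 2b =
-- 3a removes the uncontrolled last term; hence 2, 2, 3. An exact local optimum may be out of reach,
-- as real improvements can be arbitrarily small, and a stopping test would need f(T); so the number
-- of rounds is fixed in advance. The objective can rise while f(W) falls, so the best W is stored
-- apart from the current one. An element u of W ∩ T has to be exchanged for itself. Its move
-- deletes u from the other part as well, and h(u) = u makes that deletion one that the removal of
-- h(u) already pays for.

-- Arithmetic in an ordered field

module OrderedField (ℝ : RealNumbers) where
  open RealNumbers ℝ public hiding (zero)
  open IsDecTotalOrder isDecTotalOrder public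
    using (antisym; total)
    renaming (refl to ≤-refl; reflexive to ≤-reflexive; trans to ≤-trans;
              ≤-respˡ-≈ to ≤-respˡ; ≤-respʳ-≈ to ≤-respʳ)
  open CommutativeSemigroupProperties +-commutativeSemigroup using (interchange)
  open CommutativeMonoidMult +-commutativeMonoid using () renaming (×-distrib-+ to ·-distrib-+)
  open MonoidMult +-monoid public
    using () renaming (_×_ to infixr 8 _·_; ×-congʳ to ·-congʳ; ×-homo-+ to ·-homo-+;
                       ×-assocˡ to ·-assoc)
  open SemiringMult semiring using (×-assoc-*)
  open CommutativeMonoidSum +-commutativeMonoid public
    using (sum; ∑-distrib-+; sum-cong-≋; ∑-permute; sum-replicate; sum-replicate-zero)

  +-mono-≤ : ∀ {w x y z} → w ≤ x → y ≤ z → w + y ≤ x + z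
  +-mono-≤ {w} {x} {y} {z} w≤x y≤z = ≤-trans (+-monoˡ-≤ y w≤x)
    (≤-respˡ (+-comm y x) (≤-respʳ (+-comm z x) (+-monoˡ-≤ x y≤z)))

  +-cancelʳ-≤ : ∀ {x y} z → x + z ≤ y + z → x ≤ y
  +-cancelʳ-≤ z le = ≤-respˡ (cancel _) (≤-respʳ (cancel _) (+-monoˡ-≤ (- z) le))
    where
    cancel : ∀ x → (x + z) + - z ≈ x
    cancel x = trans (+-assoc x z (- z)) (trans (+-congˡ (-‿inverseʳ z)) (+-identityʳ x))

  x+[y-x]≈y : ∀ x y → x + (y - x) ≈ y
  x+[y-x]≈y x y = begin
    x + (y - x)   ≈⟨ +-comm x (y - x) ⟩
    y + - x + x   ≈⟨ +-assoc y (- x) x ⟩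
    y + (- x + x) ≈⟨ +-congˡ (-‿inverseˡ x) ⟩
    y + 0#        ≈⟨ +-identityʳ y ⟩
    y             ∎
    where open SetoidReasoning setoid

  x≤y⇒0≤y-x : ∀ {x y} → x ≤ y → 0# ≤ y - x
  x≤y⇒0≤y-x {x} {y} x≤y = ≤-respˡ (-‿inverseʳ x) (+-monoˡ-≤ (- x) x≤y)

  ·-zeroʳ : ∀ k → k · 0# ≈ 0#
  ·-zeroʳ zero    = refl
  ·-zeroʳ (suc k) = trans (+-identityˡ _) (·-zeroʳ k)

  ·-nonNegative : ∀ k {x} → 0# ≤ x → 0# ≤ k · x
  ·-nonNegative zero    0≤x = ≤-refl
  ·-nonNegative (suc k) 0≤x = ≤-respˡ (+-identityˡ 0#) (+-mono-≤ 0≤x (·-nonNegative k 0≤x))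

  ·-monoʳ-≤ : ∀ k {x y} → x ≤ y → k · x ≤ k · y
  ·-monoʳ-≤ zero    x≤y = ≤-refl
  ·-monoʳ-≤ (suc k) x≤y = +-mono-≤ x≤y (·-monoʳ-≤ k x≤y)

  ·-monoˡ-≤ : ∀ {j k x} → 0# ≤ x → j ℕ.≤ k → j · x ≤ k · x
  ·-monoˡ-≤ {k = k} 0≤x ℕ.z≤n       = ·-nonNegative k 0≤x
  ·-monoˡ-≤         0≤x (ℕ.s≤s j≤k) = +-mono-≤ ≤-refl (·-monoˡ-≤ 0≤x j≤k)

  ·-cancelˡ-≤ : ∀ k {x y} → suc k · x ≤ suc k · y → x ≤ y
  ·-cancelˡ-≤ k {x} {y} le with total x y
  ... | inj₁ x≤y = x≤y
  ... | inj₂ y≤x = +-cancelʳ-≤ (k · x) (≤-trans le (+-mono-≤ ≤-refl (·-monoʳ-≤ k y≤x)))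

  sum-mono-≤ : ∀ {n} {s t : Fin n → Carrier} → (∀ i → s i ≤ t i) → sum s ≤ sum t
  sum-mono-≤ {zero}  le = ≤-refl
  sum-mono-≤ {suc n} le = +-mono-≤ (le zero) (sum-mono-≤ (λ i → le (suc i)))

  sum-· : ∀ {n} k (s : Fin n → Carrier) → sum (λ i → k · s i) ≈ k · sum s
  sum-· {n} zero s = sum-replicate-zero n
  sum-· (suc k) s = trans (∑-distrib-+ s (λ i → k · s i)) (+-congˡ (sum-· k s))

  ≤-from : ∀ {P Q x y} → P ≤ Q → x + Q ≈ y + P → x ≤ y
  ≤-from {P} {Q} {x} {y} P≤Q eq = +-cancelʳ-≤ Q
    (≤-respˡ (sym eq) (+-mono-≤ ≤-refl P≤Q))

  infixl 6 _⊹_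
  infixr 8 _⊛_

  -- Proof by reflection: forms with equal coefficient vectors have equal values, so an identity is
  -- settled by `≡.refl` on evaluated vectors. Atoms may be arbitrary reals; for evaluation to
  -- succeed the multipliers have to be numerals.
  data Linear (k : ℕ) : Set where
    nil : Linear k
    var : Fin k → Linear k
    _⊹_ : Linear k → Linear k → Linear k
    _⊛_ : ℕ → Linear k → Linear k

  ⟦_⟧ : ∀ {k} → Linear k → Vec Carrier k → Carrier
  ⟦ nil   ⟧ ρ = 0#
  ⟦ var i ⟧ ρ = Vec.lookup ρ i
  ⟦ d ⊹ e ⟧ ρ = ⟦ d ⟧ ρ + ⟦ e ⟧ ρ
  ⟦ c ⊛ e ⟧ ρ = c · ⟦ e ⟧ ρ

  private
    unit : ∀ {k} → Fin k → Vec ℕ k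
    unit zero    = 1 ∷ Vec.replicate _ 0
    unit (suc i) = 0 ∷ unit i

    combination : ∀ {k} → Vec ℕ k → Vec Carrier k → Carrier
    combination []       []      = 0#
    combination (c ∷ cs) (x ∷ ρ) = c · x + combination cs ρ

    combination-zero : ∀ {k} (ρ : Vec Carrier k) →
                       combination (Vec.replicate _ 0) ρ ≈ 0#
    combination-zero []      = refl
    combination-zero (x ∷ ρ) = trans (+-identityˡ _) (combination-zero ρ)

    combination-unit : ∀ {k} (i : Fin k) ρ → combination (unit i) ρ ≈ Vec.lookup ρ i
    combination-unit zero    (x ∷ ρ) =
      trans (+-cong (+-identityʳ x) (combination-zero ρ)) (+-identityʳ x)
    combination-unit (suc i) (x ∷ ρ) = trans (+-identityˡ _) (combination-unit i ρ)

    combination-+ : ∀ {k} (cs ds : Vec ℕ k) ρ →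
      combination (Vec.zipWith ℕ._+_ cs ds) ρ ≈ combination cs ρ + combination ds ρ
    combination-+ []       []       []      = sym (+-identityˡ 0#)
    combination-+ (c ∷ cs) (d ∷ ds) (x ∷ ρ) =
      trans (+-cong (·-homo-+ x c d) (combination-+ cs ds ρ)) (interchange _ _ _ _)

    combination-· : ∀ {k} b (cs : Vec ℕ k) ρ →
      combination (Vec.map (b ℕ.*_) cs) ρ ≈ b · combination cs ρ
    combination-· b []       []      = sym (·-zeroʳ b)
    combination-· b (c ∷ cs) (x ∷ ρ) =
      trans (+-cong (sym (·-assoc x b c)) (combination-· b cs ρ)) (sym (·-distrib-+ _ _ b))

  coefficients : ∀ {k} → Linear k → Vec ℕ k
  coefficients nil     = Vec.replicate _ 0
  coefficients (var i) = unit i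
  coefficients (d ⊹ e) = Vec.zipWith ℕ._+_ (coefficients d) (coefficients e)
  coefficients (c ⊛ e) = Vec.map (c ℕ.*_) (coefficients e)

  private
    combination-correct : ∀ {k} (e : Linear k) ρ → combination (coefficients e) ρ ≈ ⟦ e ⟧ ρ
    combination-correct nil     ρ = combination-zero ρ
    combination-correct (var i) ρ = combination-unit i ρ
    combination-correct (d ⊹ e) ρ =
      trans (combination-+ (coefficients d) (coefficients e) ρ)
            (+-cong (combination-correct d ρ) (combination-correct e ρ))
    combination-correct (c ⊛ e) ρ =
      trans (combination-· c (coefficients e) ρ) (·-congʳ c (combination-correct e ρ))

  linear : ∀ {k} (ρ : Vec Carrier k) (d e : Linear k) →
           coefficients d ≡ coefficients e → ⟦ d ⟧ ρ ≈ ⟦ e ⟧ ρ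
  linear ρ d e eq = trans (sym (combination-correct d ρ))
    (trans (reflexive (≡.cong (λ cs → combination cs ρ) eq)) (combination-correct e ρ))

  -- The equation says that `y` - `x` and `Q` - `P` are the same form, arranged without subtraction
  -- because coefficients are natural. In its uses `P` ≤ `Q` is the sum of the inequalities to be
  -- combined, with their multipliers.
  linear-≤ : ∀ {k} (ρ : Vec Carrier k) (P Q x y : Linear k) →
             coefficients (x ⊹ Q) ≡ coefficients (y ⊹ P) →
             ⟦ P ⟧ ρ ≤ ⟦ Q ⟧ ρ → ⟦ x ⟧ ρ ≤ ⟦ y ⟧ ρ
  linear-≤ ρ P Q x y eq P≤Q = ≤-from P≤Q (linear ρ (x ⊹ Q) (y ⊹ P) eq)

  0≤1 : 0# ≤ 1#
  0≤1 with total 0# 1#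
  ... | inj₁ 0≤1 = 0≤1
  ... | inj₂ 1≤0 = ≤-respʳ [-1]²≈1 (*-nonNegative 0≤-1 0≤-1)
    where
    0≤-1 : 0# ≤ - 1#
    0≤-1 = ≤-respʳ (+-identityˡ (- 1#)) (x≤y⇒0≤y-x 1≤0)
    open RingProperties ring using (-1*x≈-x; -‿involutive)
    [-1]²≈1 : - 1# * - 1# ≈ 1#
    [-1]²≈1 = trans (-1*x≈-x (- 1#)) (-‿involutive 1#)

  fromℕ-suc≉0 : ∀ k → ¬ (fromℕ (suc k) ≈ 0#)
  fromℕ-suc≉0 k eq = 0≉1 (antisym 0≤1 (≤-respʳ eq 1≤suc))
    where
    1≤suc : 1# ≤ fromℕ (suc k)
    1≤suc = ≤-respˡ (+-identityʳ 1#) (+-mono-≤ ≤-refl (·-nonNegative k 0≤1))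

  fromℕ-* : ∀ k x → fromℕ k * x ≈ k · x
  fromℕ-* k x = trans (×-assoc-* k 1# x) (·-congʳ k (*-identityˡ x))

  ÷-*-≤ : ∀ p q {x y} → p · x ≤ suc q · y → (fromℕ p ÷ fromℕ (suc q)) * x ≤ y
  ÷-*-≤ p q {x} {y} le with fromℕ (suc q) ≟ 0#
  ... | yes q≈0 = contradiction q≈0 (fromℕ-suc≉0 q)
  ... | no  q≉0 = ·-cancelˡ-≤ q (≤-respˡ (sym eq) le)
    where
    r = proj₁ (inverse (fromℕ (suc q)) q≉0)
    open SetoidReasoning setoid
    eq : suc q · (fromℕ p * r * x) ≈ p · x
    eq = begin
      suc q · (fromℕ p * r * x)           ≈⟨ fromℕ-* (suc q) _ ⟨
      fromℕ (suc q) * (fromℕ p * r * x)   ≈⟨ *-congˡ (*-congʳ (*-comm (fromℕ p) r)) ⟩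
      fromℕ (suc q) * (r * fromℕ p * x)   ≈⟨ *-congˡ (*-assoc r (fromℕ p) x) ⟩
      fromℕ (suc q) * (r * (fromℕ p * x)) ≈⟨ *-assoc (fromℕ (suc q)) r _ ⟨
      fromℕ (suc q) * r * (fromℕ p * x)   ≈⟨ *-congʳ (proj₂ (inverse (fromℕ (suc q)) q≉0)) ⟩
      1# * (fromℕ p * x)                  ≈⟨ *-identityˡ _ ⟩
      fromℕ p * x                         ≈⟨ fromℕ-* p x ⟩
      p · x                               ∎

  -- The first hypothesis is p / (q + 1) ≤ p′ / (q′ + 1) with denominators cleared. Chained with the
  -- bound on `y` it leaves a common factor q′ + 1, which cancels.
  ratio-≤ : ∀ p q p′ q′ {x y} → p ℕ.* suc q′ ℕ.≤ suc q ℕ.* p′ →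
            0# ≤ x → p′ · x ≤ suc q′ · y → p · x ≤ suc q · y
  ratio-≤ p q p′ q′ {x} {y} cross 0≤x le = ·-cancelˡ-≤ q′
    (≤-trans (≤-reflexive (trans (·-assoc x (suc q′) p) (reflexive (≡.cong (_· x) (ℕ.*-comm (suc q′) p)))))
    (≤-trans (·-monoˡ-≤ 0≤x cross)
    (≤-trans (≤-reflexive (sym (·-assoc x (suc q) p′)))
    (≤-trans (·-monoʳ-≤ (suc q) le)
    (≤-reflexive (trans (·-assoc y (suc q) (suc q′))
      (trans (reflexive (≡.cong (_· y) (ℕ.*-comm (suc q) (suc q′)))) (sym (·-assoc y (suc q′) (suc q))))))))))

module Maximum (ℝ : RealNumbers) where
  open OrderedField ℝ

  -- Exhaustive search, for the analysis only: it supplies the optimal set to compare with and is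
  -- not part of the program. Either half of the subsets may contain none with `P`, hence the
  -- disjunction.
  find-maximum : ∀ {n} (f : SetFunction ℝ n) {P : Subset n → Set} → Decidable P →
                 (∀ S → ¬ P S) ⊎ ∃ λ T → P T × (∀ S → P S → f S ≤ f T)
  find-maximum {zero} f P? with P? []
  ... | yes p = inj₂ ([] , p , λ { [] _ → ≤-refl })
  ... | no ¬p = inj₁ λ { [] → ¬p }
  find-maximum {suc n} f P?
    with find-maximum (f ∘ (inside ∷_)) (P? ∘ (inside ∷_))
       | find-maximum (f ∘ (outside ∷_)) (P? ∘ (outside ∷_))
  ... | inj₁ ¬in | inj₁ ¬out = inj₁ λ { (inside ∷ S) → ¬in S ; (outside ∷ S) → ¬out S }
  ... | inj₂ (T , p , max) | inj₁ ¬out =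
    inj₂ (inside ∷ T , p , λ { (inside ∷ S) → max S ; (outside ∷ S) q → contradiction q (¬out S) })
  ... | inj₁ ¬in | inj₂ (T , p , max) =
    inj₂ (outside ∷ T , p , λ { (inside ∷ S) q → contradiction q (¬in S) ; (outside ∷ S) → max S })
  ... | inj₂ (T , p , max) | inj₂ (T′ , p′ , max′) with total (f (inside ∷ T)) (f (outside ∷ T′))
  ... | inj₁ le = inj₂ (outside ∷ T′ , p′ ,
    λ { (inside ∷ S) q → ≤-trans (max S q) le ; (outside ∷ S) → max′ S })
  ... | inj₂ le = inj₂ (inside ∷ T , p ,
    λ { (inside ∷ S) → max S ; (outside ∷ S) q → ≤-trans (max′ S q) le })

-- Finite subsets

private variable
  n : ℕ
  u v x y : Fin n
  A B S T : Subset n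

x∈p─q⁻ : ∀ (p q : Subset n) → x ∈ p ─ q → x ∈ p × x ∉ q
x∈p─q⁻ (inside  ∷ p) (outside ∷ q) here        = here , λ ()
x∈p─q⁻ (_ ∷ p)       (inside  ∷ q) (there x∈) with x∈p─q⁻ p q x∈
... | x∈p , x∉q = there x∈p , λ { (there x∈q) → x∉q x∈q }
x∈p─q⁻ (_ ∷ p)       (outside ∷ q) (there x∈) with x∈p─q⁻ p q x∈
... | x∈p , x∉q = there x∈p , λ { (there x∈q) → x∉q x∈q }

x∈p-y⁻ : ∀ (p : Subset n) y → x ∈ p ∖ y → x ∈ p × x ≢ y
x∈p-y⁻ p y x∈ with x∈p─q⁻ p ⁅ y ⁆ x∈
... | x∈p , x∉y = x∈p , x∉⁅y⁆⇒x≢y x∉y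

x∈p∪⁅y⁆⁻ : ∀ (p : Subset n) y → x ∈ p ∪ ⁅ y ⁆ → x ∈ p ⊎ x ≡ y
x∈p∪⁅y⁆⁻ p y x∈ with x∈p∪q⁻ p ⁅ y ⁆ x∈
... | inj₁ x∈p = inj₁ x∈p
... | inj₂ x∈y = inj₂ (x∈⁅y⁆⇒x≡y y x∈y)

∈-∪⁅⁆ˡ : x ∈ S → x ∈ S ∪ ⁅ u ⁆
∈-∪⁅⁆ˡ = p⊆p∪q _

∈-∪⁅⁆ʳ : u ∈ S ∪ ⁅ u ⁆
∈-∪⁅⁆ʳ {u = u} = q⊆p∪q _ _ (x∈⁅x⁆ u)

p∪⁅x⁆⊆q : S ⊆ T → u ∈ T → S ∪ ⁅ u ⁆ ⊆ T
p∪⁅x⁆⊆q {S = S} {u = u} S⊆T u∈T x∈ with x∈p∪⁅y⁆⁻ S u x∈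
... | inj₁ x∈S    = S⊆T x∈S
... | inj₂ ≡.refl = u∈T

x∉p⇒∣p∣<∣p∪⁅x⁆∣ : u ∉ S → ∣ S ∣ ℕ.< ∣ S ∪ ⁅ u ⁆ ∣
x∉p⇒∣p∣<∣p∪⁅x⁆∣ {u = u} u∉S = p⊂q⇒∣p∣<∣q∣ (p⊆p∪q _ , u , ∈-∪⁅⁆ʳ , u∉S)

p─q-empty⇒p⊆q : Empty (S ─ T) → S ⊆ T
p─q-empty⇒p⊆q {T = T} empty {z} z∈S with z ∈? T
... | yes z∈T = z∈T
... | no  z∉T = contradiction (z , x∈p∧x∉q⇒x∈p─q z∈S z∉T) empty

∣p∪⁅x⁆∣≤ : ∀ (p : Subset n) w → ∣ p ∪ ⁅ w ⁆ ∣ ℕ.≤ suc ∣ p ∣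
∣p∪⁅x⁆∣≤ (inside  ∷ p) zero    = ℕ.s≤s (ℕ.m≤n⇒m≤1+n (ℕ.≤-reflexive (≡.cong ∣_∣ (∪-identityʳ p))))
∣p∪⁅x⁆∣≤ (outside ∷ p) zero    = ℕ.s≤s (ℕ.≤-reflexive (≡.cong ∣_∣ (∪-identityʳ p)))
∣p∪⁅x⁆∣≤ (inside  ∷ p) (suc w) = ℕ.s≤s (∣p∪⁅x⁆∣≤ p w)
∣p∪⁅x⁆∣≤ (outside ∷ p) (suc w) = ∣p∪⁅x⁆∣≤ p w

separate : {P : Fin n → Set} → Decidable P → Subset n
separate P? = Vec.tabulate (does ∘ P?)

∈-separate⁺ : {P : Fin n → Set} (P? : Decidable P) → P x → x ∈ separate P?
∈-separate⁺ {x = x} P? px =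
  lookup⇒[]= x _ (≡.trans (lookup∘tabulate (does ∘ P?) x) (dec-true (P? x) px))

∈-separate⁻ : {P : Fin n → Set} (P? : Decidable P) → x ∈ separate P? → P x
∈-separate⁻ {x = x} P? x∈ with P? x | ≡.trans (≡.sym (lookup∘tabulate (does ∘ P?) x)) ([]=⇒lookup x∈)
... | yes px | _ = px
... | no _   | ()

-- Exchange in matroids

module _ (M : Matroid n) (indep? : Decidable (Independent M)) where
  open Matroid M using (hereditary; augmentation)

  private
    Indep = Independent M

  -- Augmentation from B is repeated while the set is smaller than B. In `go`, k bounds the deficit
  -- of C against B and drops with each added element.
  extend : Indep A → Indep B → ∃ λ C → Indep C × A ⊆ C × C ⊆ A ∪ B × ∣ B ∣ ℕ.≤ ∣ C ∣
  extend {A = A} {B = B} iA iB = go ∣ B ∣ A iA id (p⊆p∪q _) (ℕ.m≤m+n _ _)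
    where
    go : ∀ k C → Indep C → A ⊆ C → C ⊆ A ∪ B → ∣ B ∣ ℕ.≤ k ℕ.+ ∣ C ∣ →
         ∃ λ C → Indep C × A ⊆ C × C ⊆ A ∪ B × ∣ B ∣ ℕ.≤ ∣ C ∣
    go zero    C iC A⊆C C⊆ le = C , iC , A⊆C , C⊆ , le
    go (suc k) C iC A⊆C C⊆ le with ∣ B ∣ ℕ.≤? ∣ C ∣
    ... | yes B≤C = C , iC , A⊆C , C⊆ , B≤C
    ... | no  B≰C with augmentation iC iB (ℕ.≰⇒> B≰C)
    ... | u , u∈B , u∉C , iCu =
      go k (C ∪ ⁅ u ⁆) iCu (∈-∪⁅⁆ˡ ∘ A⊆C) (p∪⁅x⁆⊆q C⊆ (q⊆p∪q A B u∈B))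
         (ℕ.≤-trans le (ℕ.≤-trans (ℕ.≤-reflexive (≡.sym (ℕ.+-suc k ∣ C ∣)))
           (ℕ.+-monoʳ-≤ k (x∉p⇒∣p∣<∣p∪⁅x⁆∣ u∉C))))

  -- The elements x of T with T ∖ x + y independent are the circuit of T + y
  -- without y; if S ∖ y spanned all of them, it would span y as well.
  symmetric-exchange : Indep S → Indep T → y ∈ S → y ∉ T → ¬ Indep (T ∪ ⁅ y ⁆) →
    ∃ λ x → x ∈ T × x ∉ S × Indep ((T ∖ x) ∪ ⁅ y ⁆) × Indep ((S ∖ y) ∪ ⁅ x ⁆)
  symmetric-exchange {S = S} {T = T} {y = y} iS iT y∈S y∉T dependent = result
    where
    exchangeable? : Decidable λ x → x ∈ T × Indep ((T ∖ x) ∪ ⁅ y ⁆)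
    exchangeable? x = (x ∈? T) ×-dec indep? ((T ∖ x) ∪ ⁅ y ⁆)

    X : Subset _
    X = separate exchangeable?

    X⊆T : X ⊆ T
    X⊆T = proj₁ ∘ ∈-separate⁻ exchangeable?

    -- Otherwise X + y extends to an independent C inside T + y with at least ∣T∣ elements. Since T
    -- + y is dependent, C misses some x of T, and by its size no other element of T. So T - x + y
    -- lies in C and is independent, which puts x into X and thereby into C.
    X∪y-dependent : ¬ Indep (X ∪ ⁅ y ⁆)
    X∪y-dependent iXy with extend iXy iT
    ... | C , iC , Xy⊆C , C⊆ , T≤C with nonempty? (T ─ C)
    ... | no  empty =
      dependent (hereditary (p∪⁅x⁆⊆q (p─q-empty⇒p⊆q empty) (Xy⊆C ∈-∪⁅⁆ʳ)) iC)
    ... | yes (x , x∈T─C) with x∈p─q⁻ T C x∈T─C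
    ... | x∈T , x∉C = x∉C (Xy⊆C (∈-∪⁅⁆ˡ (∈-separate⁺ exchangeable? (x∈T , hereditary T-x∪y⊆C iC))))
      where
      C⊆T∪y : C ⊆ T ∪ ⁅ y ⁆
      C⊆T∪y z∈C with x∈p∪q⁻ (X ∪ ⁅ y ⁆) T (C⊆ z∈C)
      ... | inj₁ z∈ = p∪⁅x⁆⊆q (∈-∪⁅⁆ˡ ∘ X⊆T) ∈-∪⁅⁆ʳ z∈
      ... | inj₂ z∈T = ∈-∪⁅⁆ˡ z∈T

      ∣C∣<∣T∣ : ∀ {z} → z ∈ T → z ≢ x → z ∉ C → ∣ C ∣ ℕ.< ∣ T ∣
      ∣C∣<∣T∣ {z} z∈T z≢x z∉C = ℕ.≤-trans (ℕ.s≤s (p⊆q⇒∣p∣≤∣q∣ C⊆D)) (ℕ.≤-trans (ℕ.s≤s ∣D∣≤) ∣T-x∣<)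
        where
        D = (T ∖ x ∖ z) ∪ ⁅ y ⁆
        C⊆D : C ⊆ D
        C⊆D {w} w∈C with x∈p∪⁅y⁆⁻ T y (C⊆T∪y w∈C)
        ... | inj₂ ≡.refl = ∈-∪⁅⁆ʳ
        ... | inj₁ w∈T = ∈-∪⁅⁆ˡ (x∈p∧x≢y⇒x∈p-y
          (x∈p∧x≢y⇒x∈p-y w∈T λ { ≡.refl → x∉C w∈C }) λ { ≡.refl → z∉C w∈C })
        ∣D∣≤ : ∣ D ∣ ℕ.≤ ∣ T ∖ x ∣
        ∣D∣≤ = ℕ.≤-trans (∣p∪⁅x⁆∣≤ (T ∖ x ∖ z) y) (x∈p⇒∣p-x∣<∣p∣ (x∈p∧x≢y⇒x∈p-y z∈T z≢x))
        ∣T-x∣< : ∣ T ∖ x ∣ ℕ.< ∣ T ∣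
        ∣T-x∣< = x∈p⇒∣p-x∣<∣p∣ x∈T

      T-x∪y⊆C : (T ∖ x) ∪ ⁅ y ⁆ ⊆ C
      T-x∪y⊆C = p∪⁅x⁆⊆q T-x⊆C (Xy⊆C ∈-∪⁅⁆ʳ)
        where
        T-x⊆C : T ∖ x ⊆ C
        T-x⊆C {z} z∈ with z ∈? C | x∈p-y⁻ T x z∈
        ... | yes z∈C | _ = z∈C
        ... | no  z∉C | z∈T , z≢x =
          contradiction (ℕ.<-≤-trans (∣C∣<∣T∣ z∈T z≢x z∉C) T≤C) (ℕ.<-irrefl ≡.refl)

    result : ∃ λ x → x ∈ T × x ∉ S × Indep ((T ∖ x) ∪ ⁅ y ⁆) × Indep ((S ∖ y) ∪ ⁅ x ⁆)
    -- S - y is smaller than an independent C between X and X ∪ S, so some x of C augments it. Here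
    -- x ≠ y, as C would otherwise contain X + y, and x ∉ S, as x would otherwise lie in S - y
    -- already; hence x ∈ X.
    result with extend (hereditary X⊆T iT) iS
    ... | C , iC , X⊆C , C⊆X∪S , S≤C
      with augmentation (hereditary (p─q⊆p S ⁅ y ⁆) iS) iC (ℕ.<-≤-trans (x∈p⇒∣p-x∣<∣p∣ y∈S) S≤C)
    ... | x , x∈C , x∉S-y , iS-y∪x
      with ∈-separate⁻ exchangeable? (x∈X (x∈p∪q⁻ X S (C⊆X∪S x∈C)))
      where
      x≢y : x ≢ y
      x≢y ≡.refl = X∪y-dependent (hereditary (p∪⁅x⁆⊆q X⊆C x∈C) iC)
      x∈X : x ∈ X ⊎ x ∈ S → x ∈ X
      x∈X (inj₁ x∈X) = x∈X
      x∈X (inj₂ x∈S) = contradiction (x∈p∧x≢y⇒x∈p-y x∈S x≢y) x∉S-y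
    ... | x∈T , iT-x∪y = x , x∈T , x∉S , iT-x∪y , iS-y∪x
      where
      x∉S : x ∉ S
      x∉S x∈S = x∉S-y (x∈p∧x≢y⇒x∈p-y x∈S λ { ≡.refl → y∉T x∈T })

  -- A permutation of the whole ground set, so that sums over all elements can be reindexed by it.
  -- The sizes of S and T need not agree: a partner outside S means that nothing is removed.
  record Exchange (S T : Subset n) : Set where
    field
      partner : Permutation′ n
      swapped : ∀ {u} → u ∈ T → Indep ((S ∖ (partner ⟨$⟩ʳ u)) ∪ ⁅ u ⁆)
      fixed   : ∀ {u} → u ∈ S → u ∈ T → partner ⟨$⟩ʳ u ≡ u

  exchange-superset : S ⊆ T → Indep T → Exchange S T
  exchange-superset {S = S} S⊆T iT = record
    { partner = idₚ
    ; swapped = λ u∈T → hereditary (p∪⁅x⁆⊆q (S⊆T ∘ p─q⊆p S _) u∈T) iT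
    ; fixed   = λ _ _ → ≡.refl
    }

  exchange-insert : Exchange S (T ∪ ⁅ y ⁆) → Exchange S T
  exchange-insert E = record
    { partner = E.partner
    ; swapped = λ u∈T → E.swapped (∈-∪⁅⁆ˡ u∈T)
    ; fixed   = λ u∈S u∈T → E.fixed u∈S (∈-∪⁅⁆ˡ u∈T)
    }
    where module E = Exchange E

  -- As y lies in S and in T - x + y, the given partner fixes y. Precomposed with the transposition
  -- of x and y it therefore sends x to y, and it is unchanged on the rest of T.
  exchange-transpose : x ∉ S → y ∈ S → y ∉ T → Indep ((S ∖ y) ∪ ⁅ x ⁆) →
                       Exchange S ((T ∖ x) ∪ ⁅ y ⁆) → Exchange S T
  exchange-transpose {x = x} {S = S} {y = y} {T = T} x∉S y∈S y∉T iS-y∪x E = record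
    { partner = π ; swapped = swapped ; fixed = fixed }
    where
    module E = Exchange E

    π : Permutation′ _
    π = transpose x y ∘ₚ E.partner

    π-x : π ⟨$⟩ʳ x ≡ y
    π-x rewrite dec-true (x Fin.≟ x) ≡.refl = E.fixed y∈S ∈-∪⁅⁆ʳ

    π-other : ∀ {u} → u ∈ T → u ≢ x → π ⟨$⟩ʳ u ≡ E.partner ⟨$⟩ʳ u
    π-other {u} u∈T u≢x
      rewrite dec-false (u Fin.≟ x) u≢x | dec-false (u Fin.≟ y) (λ { ≡.refl → y∉T u∈T }) = ≡.refl

    kept : ∀ {u} → u ∈ T → u ≢ x → u ∈ (T ∖ x) ∪ ⁅ y ⁆
    kept u∈T u≢x = ∈-∪⁅⁆ˡ (x∈p∧x≢y⇒x∈p-y u∈T u≢x)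

    swapped : ∀ {u} → u ∈ T → Indep ((S ∖ (π ⟨$⟩ʳ u)) ∪ ⁅ u ⁆)
    swapped {u} u∈T = at (u Fin.≟ x)
      where
      exchanged : Fin n → Set
      exchanged v = Indep ((S ∖ v) ∪ ⁅ u ⁆)
      at : Dec (u ≡ x) → exchanged (π ⟨$⟩ʳ u)
      at (yes ≡.refl) = ≡.subst exchanged (≡.sym π-x) iS-y∪x
      at (no  u≢x)    = ≡.subst exchanged (≡.sym (π-other u∈T u≢x)) (E.swapped (kept u∈T u≢x))

    fixed : ∀ {u} → u ∈ S → u ∈ T → π ⟨$⟩ʳ u ≡ u
    fixed {u} u∈S u∈T = ≡.trans (π-other u∈T u≢x) (E.fixed u∈S (kept u∈T u≢x))
      where
      u≢x : u ≢ x
      u≢x ≡.refl = x∉S u∈S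

  -- T is moved towards S until it contains S, where the identity serves. Each step brings some y of
  -- S - T into T, if necessary in exchange for an x outside S; no element of S ∩ T is lost, so ∣S -
  -- T∣ drops.
  exchange : Indep S → Indep T → Exchange S T
  exchange {S = S} {T = T} iS iT = go ∣ S ─ T ∣ iT ℕ.≤-refl
    where
    smaller : ∀ {T T′ y k} → y ∈ S → y ∉ T → y ∈ T′ → (∀ {z} → z ∈ S → z ∈ T → z ∈ T′) →
              ∣ S ─ T ∣ ℕ.≤ suc k → ∣ S ─ T′ ∣ ℕ.≤ k
    smaller {T} {T′} {y} y∈S y∉T y∈T′ sub le = ℕ.s≤s⁻¹ (ℕ.<-≤-trans (p⊂q⇒∣p∣<∣q∣
      ( (λ z∈ → let z∈S , z∉T′ = x∈p─q⁻ S T′ z∈ in x∈p∧x∉q⇒x∈p─q z∈S (z∉T′ ∘ sub z∈S))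
      , y , x∈p∧x∉q⇒x∈p─q y∈S y∉T , λ y∈ → proj₂ (x∈p─q⁻ S T′ y∈) y∈T′)) le)

    go : ∀ k {T} → Indep T → ∣ S ─ T ∣ ℕ.≤ k → Exchange S T
    go k {T} iT le with nonempty? (S ─ T)
    ... | no empty = exchange-superset (p─q-empty⇒p⊆q empty) iT
    go zero    {T} iT le | yes (y , y∈) =
      contradiction (ℕ.≤-<-trans ℕ.z≤n (x∈p⇒∣p-x∣<∣p∣ y∈)) (ℕ.≤⇒≯ le)
    go (suc k) {T} iT le | yes (y , y∈) with x∈p─q⁻ S T y∈ | indep? (T ∪ ⁅ y ⁆)
    ... | y∈S , y∉T | yes iT∪y =
      exchange-insert (go k iT∪y (smaller y∈S y∉T ∈-∪⁅⁆ʳ (λ _ → ∈-∪⁅⁆ˡ) le))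
    ... | y∈S , y∉T | no dependent with symmetric-exchange iS iT y∈S y∉T dependent
    ... | x , x∈T , x∉S , iT-x∪y , iS-y∪x =
      exchange-transpose x∉S y∈S y∉T iS-y∪x (go k iT-x∪y
        (smaller y∈S y∉T ∈-∪⁅⁆ʳ
          (λ z∈S z∈T → ∈-∪⁅⁆ˡ (x∈p∧x≢y⇒x∈p-y z∈T λ { ≡.refl → x∉S z∈S })) le))

-- Submodular functions

module SubmodularBounds (ℝ : RealNumbers) where
  open OrderedField ℝ

  when : Bool → Carrier → Carrier
  when b x = if b then x else 0#

  loss : SetFunction ℝ n → Fin n → Subset n → Carrier
  loss f v S = f S - f (S ∖ v)

  f[S]+marginal : ∀ (f : SetFunction ℝ n) u S → f S + marginal ℝ f u S ≈ f (S ∪ ⁅ u ⁆)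
  f[S]+marginal f u S = x+[y-x]≈y (f S) (f (S ∪ ⁅ u ⁆))

  f[S-v]+loss : ∀ (f : SetFunction ℝ n) v S → f (S ∖ v) + loss f v S ≈ f S
  f[S-v]+loss f v S = x+[y-x]≈y (f (S ∖ v)) (f S)

  submodular⁺ : {f : SetFunction ℝ n} → Submodular ℝ f → S ⊆ T → ∀ u → u ∉ T →
                f (T ∪ ⁅ u ⁆) + f S ≤ f (S ∪ ⁅ u ⁆) + f T
  submodular⁺ {S = S} {T = T} {f = f} submodular S⊆T u u∉T =
    ≤-respˡ (+-congʳ (f[S]+marginal f u T)) (≤-respʳ (+-congʳ (f[S]+marginal f u S))
      (linear-≤ (f S ∷ f T ∷ marginal ℝ f u S ∷ marginal ℝ f u T ∷ [])
        (var 3F) (var 2F) (var 1F ⊹ var 3F ⊹ var 0F) (var 0F ⊹ var 2F ⊹ var 1F) ≡.refl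
        (submodular S⊆T u u∉T)))

  -- Fixing the membership of the first element is deletion or, up to a constant, contraction of it.
  -- The inductions on the ground set in `cover` and `peel` run through these restrictions.
  link-monotone : {f : SetFunction ℝ (suc n)} → Monotone ℝ f → ∀ b → Monotone ℝ (f ∘ (b ∷_))
  link-monotone monotone b S⊆T = monotone (s⊆s S⊆T)

  link-submodular : {f : SetFunction ℝ (suc n)} → Submodular ℝ f →
                    ∀ b → Submodular ℝ (f ∘ (b ∷_))
  link-submodular submodular true  S⊆T u u∉T =
    submodular (s⊆s S⊆T) (suc u) λ { (there u∈T) → u∉T u∈T }
  link-submodular submodular false S⊆T u u∉T =
    submodular (s⊆s S⊆T) (suc u) λ { (there u∈T) → u∉T u∈T }

  insert-head-≤ : {f : SetFunction ℝ (suc n)} → Submodular ℝ f → S ⊆ T →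
                  f (inside ∷ T) + f (outside ∷ S) ≤ f (inside ∷ S) + f (outside ∷ T)
  insert-head-≤ {S = S} {T = T} submodular S⊆T
    with submodular⁺ submodular (s⊆s {s = outside} S⊆T) zero (λ ())
  ... | le rewrite ∪-identityʳ S | ∪-identityʳ T = le

  -- If the elements of T are added to S one by one, each increment is at most the marginal over S.
  -- Induction on the ground set replaces an enumeration of T. Submodularity enters where the first
  -- element is new to S: its increment over S ∪ T is at most that over S.
  cover : {f : SetFunction ℝ n} → Monotone ℝ f → Submodular ℝ f → ∀ S T →
          f (S ∪ T) ≤ f S + sum (λ u → when (lookup T u) (marginal ℝ f u S))
  cover monotone submodular [] [] = ≤-reflexive (sym (+-identityʳ _))
  cover {f = f} monotone submodular (inside ∷ S) (inside ∷ T) =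
    ≤-trans (cover (link-monotone monotone inside) (link-submodular submodular inside) S T)
      (+-mono-≤ ≤-refl (≤-respˡ (+-identityˡ _)
        (+-mono-≤ (x≤y⇒0≤y-x (monotone (s⊆s (p⊆p∪q _)))) ≤-refl)))
  cover monotone submodular (inside ∷ S) (outside ∷ T) =
    ≤-trans (cover (link-monotone monotone inside) (link-submodular submodular inside) S T)
      (+-mono-≤ ≤-refl (≤-reflexive (sym (+-identityˡ _))))
  cover monotone submodular (outside ∷ S) (outside ∷ T) =
    ≤-trans (cover (link-monotone monotone outside) (link-submodular submodular outside) S T)
      (+-mono-≤ ≤-refl (≤-reflexive (sym (+-identityˡ _))))
  cover {f = f} monotone submodular (outside ∷ S) (inside ∷ T) =
    linear-≤ (f (inside ∷ S ∪ T) ∷ f (outside ∷ S ∪ T) ∷ f (outside ∷ S) ∷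
              marginal ℝ f zero (outside ∷ S) ∷ rest ∷ [])
      ((var 0F ⊹ var 2F) ⊹ var 1F) ((var 2F ⊹ var 3F ⊹ var 1F) ⊹ (var 2F ⊹ var 4F))
      (var 0F) (var 2F ⊹ (var 3F ⊹ var 4F)) ≡.refl
      (+-mono-≤ (≤-respʳ (+-congʳ (sym gain)) (insert-head-≤ submodular (p⊆p∪q T)))
        (cover (link-monotone monotone outside) (link-submodular submodular outside) S T))
    where
    rest = sum (λ u → when (lookup T u) (marginal ℝ (f ∘ (outside ∷_)) u S))
    gain : f (outside ∷ S) + marginal ℝ f zero (outside ∷ S) ≈ f (inside ∷ S)
    gain = trans (f[S]+marginal f zero (outside ∷ S))
                 (reflexive (≡.cong (f ∘ (inside ∷_)) (∪-identityʳ S)))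

  -- The counterpart of `cover` for removals: taken away one by one, each element of T costs at
  -- least what its removal from the full S costs.
  peel : {f : SetFunction ℝ n} → Submodular ℝ f → ∀ S T →
         f (S ─ T) + sum (λ v → when (lookup T v) (loss f v S)) ≤ f S
  peel submodular [] [] = ≤-reflexive (+-identityʳ _)
  peel submodular (a ∷ S) (outside ∷ T) =
    ≤-respˡ (+-congˡ (sym (+-identityˡ _))) (peel (link-submodular submodular a) S T)
  peel {f = f} submodular (a ∷ S) (inside ∷ T) = ≤-respʳ gain
    (linear-≤ (f (outside ∷ (S ─ T)) ∷ rest ∷ f (outside ∷ S) ∷ loss f zero (a ∷ S) ∷ [])
      (var 0F ⊹ var 1F) (var 2F) (var 0F ⊹ (var 3F ⊹ var 1F)) (var 2F ⊹ var 3F) ≡.refl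
      (without-head a))
    where
    losses : Bool → Carrier
    losses b = sum (λ v → when (lookup T v) (loss (f ∘ (b ∷_)) v S))
    rest = losses a
    gain : f (outside ∷ S) + loss f zero (a ∷ S) ≈ f (a ∷ S)
    gain = trans (+-congʳ (reflexive (≡.cong (f ∘ (outside ∷_)) (≡.sym (p─⊥≡p S)))))
                 (f[S-v]+loss f zero (a ∷ S))
    -- The losses refer to a set that may contain the first element, the values of f to sets without
    -- it. If it is present, `insert-head-≤` transfers the bound: removing the rest of T costs no
    -- less once the first element is gone.
    without-head : ∀ b → f (outside ∷ (S ─ T)) + losses b ≤ f (outside ∷ S)
    without-head false = peel (link-submodular submodular outside) S T
    without-head true  =
      linear-≤ (f (outside ∷ (S ─ T)) ∷ f (inside ∷ (S ─ T)) ∷ f (outside ∷ S) ∷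
                f (inside ∷ S) ∷ losses true ∷ [])
        ((var 3F ⊹ var 0F) ⊹ (var 1F ⊹ var 4F)) ((var 1F ⊹ var 2F) ⊹ var 3F)
        (var 0F ⊹ var 4F) (var 2F) ≡.refl
        (+-mono-≤ (insert-head-≤ submodular (p─q⊆p S T))
                  (peel (link-submodular submodular inside) S T))

  sum-combination : ∀ i j k (r s t : Fin n → Carrier) →
    sum (λ u → i · r u + j · s u + k · t u) ≈ i · sum r + j · sum s + k · sum t
  sum-combination i j k r s t =
    trans (∑-distrib-+ (λ u → i · r u + j · s u) (λ u → k · t u))
      (+-cong (trans (∑-distrib-+ (λ u → i · r u) (λ u → j · s u)) (+-cong (sum-· i r) (sum-· j s)))
        (sum-· k t))

-- Local optima

-- `Split` makes `whole` the union of the two parts. It is stored separately because the program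
-- keeps it in a row of its own for oracle queries.
record Config (n : ℕ) : Set where
  constructor ⟪_,_,_⟫
  field
    left right whole : Subset n

open Config

mirror : Config n → Config n
mirror Z = ⟪ right Z , left Z , whole Z ⟫

-- Deleting `u` on the right keeps the parts disjoint when `u` is already present. With v = u in the
-- right part, the move is a transfer of u to the left.
move : Fin n → Fin n → Config n → Config n
move u v Z = ⟪ (left Z ∖ v) ∪ ⁅ u ⁆ , right Z ∖ v ∖ u , (whole Z ∖ v) ∪ ⁅ u ⁆ ⟫

record Split (Z : Config n) : Set where
  field
    left⊆whole  : left Z ⊆ whole Z
    right⊆whole : right Z ⊆ whole Z
    covered     : x ∈ whole Z → x ∈ left Z ⊎ x ∈ right Z
    disjoint    : x ∈ left Z → x ∉ right Z

mirror-split : {Z : Config n} → Split Z → Split (mirror Z)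
mirror-split split = record
  { left⊆whole  = right⊆whole
  ; right⊆whole = left⊆whole
  ; covered     = λ x∈ → [ inj₂ , inj₁ ]′ (covered x∈)
  ; disjoint    = λ x∈R x∈L → disjoint x∈L x∈R
  }
  where open Split split

move-split : ∀ (u v : Fin n) {Z} → Split Z → Split (move u v Z)
move-split u v {Z} split = record
  { left⊆whole  = p∪⁅x⁆⊆q (∈-∪⁅⁆ˡ ∘ ∖-mono left⊆whole) ∈-∪⁅⁆ʳ
  ; right⊆whole = λ x∈ → ∈-∪⁅⁆ˡ (∖-mono right⊆whole (proj₁ (x∈p-y⁻ (right Z ∖ v) u x∈)))
  ; covered     = covered′
  ; disjoint    = disjoint′
  }
  where
  open Split split

  ∖-mono : S ⊆ T → S ∖ v ⊆ T ∖ v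
  ∖-mono {S = S} S⊆T x∈ with x∈p-y⁻ S v x∈
  ... | x∈S , x≢v = x∈p∧x≢y⇒x∈p-y (S⊆T x∈S) x≢v

  covered′ : x ∈ (whole Z ∖ v) ∪ ⁅ u ⁆ → x ∈ (left Z ∖ v) ∪ ⁅ u ⁆ ⊎ x ∈ right Z ∖ v ∖ u
  covered′ {x = x} x∈ with x∈p∪⁅y⁆⁻ (whole Z ∖ v) u x∈ | x ∈? ⁅ u ⁆
  ... | _         | yes x∈u = inj₁ (q⊆p∪q _ _ x∈u)
  ... | inj₂ ≡.refl | no x∉u = contradiction (x∈⁅x⁆ u) x∉u
  ... | inj₁ x∈∖v | no x∉u with x∈p-y⁻ (whole Z) v x∈∖v
  ... | x∈W , x≢v with covered x∈W
  ... | inj₁ x∈L = inj₁ (∈-∪⁅⁆ˡ (x∈p∧x≢y⇒x∈p-y x∈L x≢v))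
  ... | inj₂ x∈R = inj₂ (x∈p∧x∉q⇒x∈p─q (x∈p∧x≢y⇒x∈p-y x∈R x≢v) x∉u)

  disjoint′ : x ∈ (left Z ∖ v) ∪ ⁅ u ⁆ → x ∉ right Z ∖ v ∖ u
  disjoint′ x∈L x∈R with x∈p-y⁻ (right Z ∖ v) u x∈R
  ... | x∈R∖v , x≢u with x∈p∪⁅y⁆⁻ (left Z ∖ v) u x∈L
  ... | inj₂ x≡u   = x≢u x≡u
  ... | inj₁ x∈L∖v = disjoint (proj₁ (x∈p-y⁻ (left Z) v x∈L∖v)) (proj₁ (x∈p-y⁻ (right Z) v x∈R∖v))

module LocalSearch (ℝ : RealNumbers) (f : SetFunction ℝ n) where
  open OrderedField ℝ
  open SubmodularBounds ℝ

  -- With these weights the coefficients of f (left Z) and f (right Z)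
  -- cancel when the bounds over all moves are added up.
  objective : Config n → Carrier
  objective Z = 2 · f (left Z) + 2 · f (right Z) + 3 · f (whole Z)

  module _ (nonNegative : NonNegative ℝ f) (monotone : Monotone ℝ f)
           (submodular : Submodular ℝ f) where

    loss-nonNegative : ∀ v S → 0# ≤ loss f v S
    loss-nonNegative v S = x≤y⇒0≤y-x (monotone (p─q⊆p S ⁅ v ⁆))

    -- For u ∉ S, inserting u after the removal of v gains at least its marginal over the full S.
    -- For u ∈ S that marginal vanishes and monotonicity suffices.
    swap-gain : ∀ u v S → marginal ℝ f u S + f S ≤ f ((S ∖ v) ∪ ⁅ u ⁆) + loss f v S
    swap-gain u v S = ≤-from bound
      (linear (f S ∷ f (S ∖ v) ∷ marginal ℝ f u S ∷ loss f v S ∷ swapped ∷ [])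
         ((m ⊹ a) ⊹ (s ⊹ (b ⊹ d))) ((s ⊹ d) ⊹ ((a ⊹ m) ⊹ b)) ≡.refl)
      where
      swapped = f ((S ∖ v) ∪ ⁅ u ⁆)
      a b m d s : Linear 5
      a = var 0F ; b = var 1F ; m = var 2F ; d = var 3F ; s = var 4F

      bound′ : f (S ∪ ⁅ u ⁆) + f (S ∖ v) ≤ swapped + f S
      bound′ with u ∈? S
      ... | no  u∉S = submodular⁺ submodular (p─q⊆p S ⁅ v ⁆) u u∉S
      ... | yes u∈S = ≤-respʳ (+-comm _ _)
        (+-mono-≤ (monotone (p∪⁅x⁆⊆q id u∈S)) (monotone (p⊆p∪q _)))

      bound : (f S + marginal ℝ f u S) + f (S ∖ v) ≤ swapped + (f (S ∖ v) + loss f v S)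
      bound = ≤-respˡ (+-congʳ (sym (f[S]+marginal f u S)))
                (≤-respʳ (+-congˡ (sym (f[S-v]+loss f v S))) bound′)

    -- `swap-gain` is applied to the left part and to the whole. On the right, deleting u after v
    -- changes nothing: u could be there only if v = u.
    move-gain : ∀ {u v} (Z : Config n) → right Z ⊆ whole Z → (u ∈ whole Z → v ≡ u) →
      2 · marginal ℝ f u (left Z) + 3 · marginal ℝ f u (whole Z) + objective Z ≤
      objective (move u v Z) +
      (2 · loss f v (left Z) + 2 · loss f v (right Z) + 3 · loss f v (whole Z))
    move-gain {u} {v} Z R⊆W fixed =
      linear-≤ (f L ∷ f R ∷ f W ∷ f ((L ∖ v) ∪ ⁅ u ⁆) ∷ f (R ∖ v ∖ u) ∷ f ((W ∖ v) ∪ ⁅ u ⁆) ∷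
                marginal ℝ f u L ∷ marginal ℝ f u W ∷
                loss f v L ∷ loss f v R ∷ loss f v W ∷ [])
        (2 ⊛ (mL ⊹ l) ⊹ 2 ⊛ r ⊹ 3 ⊛ (mW ⊹ w))
        (2 ⊛ (l′ ⊹ dL) ⊹ 2 ⊛ (r′ ⊹ dR) ⊹ 3 ⊛ (w′ ⊹ dW))
        (2 ⊛ mL ⊹ 3 ⊛ mW ⊹ (2 ⊛ l ⊹ 2 ⊛ r ⊹ 3 ⊛ w))
        ((2 ⊛ l′ ⊹ 2 ⊛ r′ ⊹ 3 ⊛ w′) ⊹ (2 ⊛ dL ⊹ 2 ⊛ dR ⊹ 3 ⊛ dW)) ≡.refl
        (+-mono-≤ (+-mono-≤ (·-monoʳ-≤ 2 (swap-gain u v L)) (·-monoʳ-≤ 2 right-bound))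
          (·-monoʳ-≤ 3 (swap-gain u v W)))
      where
      L = left Z
      R = right Z
      W = whole Z
      l r w l′ r′ w′ mL mW dL dR dW : Linear 11
      l = var 0F ; r = var 1F ; w = var 2F ; l′ = var 3F ; r′ = var 4F ; w′ = var 5F
      mL = var 6F ; mW = var 7F ; dL = var 8F ; dR = var 9F ; dW = var (suc 9F)

      R∖v⊆ : R ∖ v ⊆ R ∖ v ∖ u
      R∖v⊆ x∈ with x∈p-y⁻ R v x∈
      ... | x∈R , x≢v = x∈p∧x≢y⇒x∈p-y x∈ λ { ≡.refl → x≢v (≡.sym (fixed (R⊆W x∈R))) }

      right-bound : f R ≤ f (R ∖ v ∖ u) + loss f v R
      right-bound = ≤-respˡ (f[S-v]+loss f v R) (+-mono-≤ (monotone R∖v⊆) ≤-refl)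

    module _ (M : Matroid n) (indep? : Decidable (Independent M)) where

      -- The marginals add up to at least 10 f(T) - 2 f(L) - 2 f(R) - 6 f(W). The losses, each v
      -- being charged once as a partner, are at most 4 f(L) + 4 f(R) + 6 (2 f(W) - f(L) - f(R)). In
      -- the difference f(L) and f(R) cancel. The factor n is the number of elements summed over.
      progress : ∀ (Z : Config n) T best → Split Z → Independent M (whole Z) → Independent M T →
        objective Z ≤ best →
        (∀ u v → Independent M ((whole Z ∖ v) ∪ ⁅ u ⁆) →
                 objective (move u v Z) ≤ best × objective (move u v (mirror Z)) ≤ best) →
        10 · f T + n · (2 · objective Z) ≤ 18 · f (whole Z) + n · (2 · best)
      progress Z T best split iW iT Z≤best moves≤best =
        -- The multiples by n are atoms, since n is not a numeral.
        linear-≤ (f L ∷ f R ∷ f W ∷ f T ∷ n · (2 · objective Z) ∷ n · (2 · best) ∷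
                  sum gL ∷ sum gR ∷ sum gW ∷ sum dL ∷ sum dR ∷ sum dW ∷ [])
          (((2 ⊛ t ⊹ 2 ⊛ t ⊹ 6 ⊛ t) ⊹ (2 ⊛ sgL ⊹ 2 ⊛ sgR ⊹ 6 ⊛ sgW ⊹ nG)) ⊹
             (4 ⊛ sdL ⊹ 4 ⊛ sdR ⊹ 6 ⊛ (r ⊹ l ⊹ sdW)))
          (((2 ⊛ (l ⊹ sgL) ⊹ 2 ⊛ (r ⊹ sgR) ⊹ 6 ⊛ (w ⊹ sgW)) ⊹ (nB ⊹ (4 ⊛ sdL ⊹ 4 ⊛ sdR ⊹ 6 ⊛ sdW))) ⊹
             (4 ⊛ l ⊹ 4 ⊛ r ⊹ 6 ⊛ (w ⊹ w)))
          (10 ⊛ t ⊹ nG) (18 ⊛ w ⊹ nB) ≡.refl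
          (+-mono-≤ (+-mono-≤
            (+-mono-≤ (+-mono-≤ (·-monoʳ-≤ 2 (gains L)) (·-monoʳ-≤ 2 (gains R))) (·-monoʳ-≤ 6 (gains W)))
            summed)
            (+-mono-≤ (+-mono-≤ (·-monoʳ-≤ 4 (losses L)) (·-monoʳ-≤ 4 (losses R)))
              (·-monoʳ-≤ 6 whole-losses)))
        where
        open Split split
        L = left Z
        R = right Z
        W = whole Z
        l r w t nG nB sgL sgR sgW sdL sdR sdW : Linear 12
        l = var 0F ; r = var 1F ; w = var 2F ; t = var 3F ; nG = var 4F ; nB = var 5F
        sgL = var 6F ; sgR = var 7F ; sgW = var 8F ; sdL = var 9F
        sdR = var (suc 9F) ; sdW = var (suc (suc 9F))

        module E = Exchange (exchange M indep? iW iT)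
        h : Fin n → Fin n
        h = E.partner ⟨$⟩ʳ_

        gL gR gW dL dR dW : Fin n → Carrier
        gL u = when (lookup T u) (marginal ℝ f u L)
        gR u = when (lookup T u) (marginal ℝ f u R)
        gW u = when (lookup T u) (marginal ℝ f u W)
        dL v = loss f v L
        dR v = loss f v R
        dW v = loss f v W

        losses-nonNegative : ∀ v → 0# ≤ 4 · dL v + 4 · dR v + 6 · dW v
        losses-nonNegative v = ≤-respˡ (linear [] (nil ⊹ nil ⊹ nil) nil ≡.refl)
          (+-mono-≤ (+-mono-≤ (·-nonNegative 4 (loss-nonNegative v L))
              (·-nonNegative 4 (loss-nonNegative v R)))
            (·-nonNegative 6 (loss-nonNegative v W)))

        step : ∀ u → 2 · gL u + 2 · gR u + 6 · gW u + 2 · objective Z ≤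
                     2 · best + (4 · dL (h u) + 4 · dR (h u) + 6 · dW (h u))
        step u with lookup T u in eq
        -- No move is made for u outside T. Its nonnegative losses are added all the same, so that
        -- the sum runs over the whole ground set and can be reindexed by h.
        ... | false = linear-≤ (objective Z ∷ best ∷ (4 · dL (h u) + 4 · dR (h u) + 6 · dW (h u)) ∷ [])
          (nil ⊹ 2 ⊛ var 0F) (var 2F ⊹ 2 ⊛ var 1F)
          (2 ⊛ nil ⊹ 2 ⊛ nil ⊹ 6 ⊛ nil ⊹ 2 ⊛ var 0F) (2 ⊛ var 1F ⊹ var 2F) ≡.refl
          (+-mono-≤ (losses-nonNegative (h u)) (·-monoʳ-≤ 2 Z≤best))
        ... | true =
          linear-≤ (f L ∷ f R ∷ f W ∷ best ∷ marginal ℝ f u L ∷ marginal ℝ f u R ∷ marginal ℝ f u W ∷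
                    dL (h u) ∷ dR (h u) ∷ dW (h u) ∷ [])
            ((2 ⊛ mL ⊹ 3 ⊛ mW ⊹ (2 ⊛ fL ⊹ 2 ⊛ fR ⊹ 3 ⊛ fW)) ⊹ (2 ⊛ mR ⊹ 3 ⊛ mW ⊹ (2 ⊛ fR ⊹ 2 ⊛ fL ⊹ 3 ⊛ fW)))
            ((b ⊹ (2 ⊛ eL ⊹ 2 ⊛ eR ⊹ 3 ⊛ eW)) ⊹ (b ⊹ (2 ⊛ eR ⊹ 2 ⊛ eL ⊹ 3 ⊛ eW)))
            (2 ⊛ mL ⊹ 2 ⊛ mR ⊹ 6 ⊛ mW ⊹ 2 ⊛ (2 ⊛ fL ⊹ 2 ⊛ fR ⊹ 3 ⊛ fW))
            (2 ⊛ b ⊹ (4 ⊛ eL ⊹ 4 ⊛ eR ⊹ 6 ⊛ eW)) ≡.refl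
            (+-mono-≤
              (≤-trans (move-gain Z right⊆whole fixed) (+-mono-≤ (proj₁ improved) ≤-refl))
              (≤-trans (move-gain (mirror Z) left⊆whole fixed) (+-mono-≤ (proj₂ improved) ≤-refl)))
          where
          fL fR fW b mL mR mW eL eR eW : Linear 10
          fL = var 0F ; fR = var 1F ; fW = var 2F ; b = var 3F ; mL = var 4F ; mR = var 5F
          mW = var 6F ; eL = var 7F ; eR = var 8F ; eW = var 9F
          u∈T : u ∈ T
          u∈T = lookup⇒[]= u T eq
          fixed : u ∈ W → h u ≡ u
          fixed u∈W = E.fixed u∈W u∈T
          improved = moves≤best u (h u) (E.swapped u∈T)

        summed : 2 · sum gL + 2 · sum gR + 6 · sum gW + n · (2 · objective Z) ≤
                 n · (2 · best) + (4 · sum dL + 4 · sum dR + 6 · sum dW)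
        summed = ≤-respˡ
          (trans (∑-distrib-+ (λ u → 2 · gL u + 2 · gR u + 6 · gW u) (λ _ → 2 · objective Z))
            (+-cong (sum-combination 2 2 6 gL gR gW) (sum-replicate n)))
          (≤-respʳ
            (trans (∑-distrib-+ (λ _ → 2 · best) (λ u → 4 · dL (h u) + 4 · dR (h u) + 6 · dW (h u)))
              (+-cong (sum-replicate n)
              (trans (sym (∑-permute (λ v → 4 · dL v + 4 · dR v + 6 · dW v) E.partner))
                (sum-combination 4 4 6 dL dR dW))))
            (sum-mono-≤ step))

        gains : ∀ S → f T ≤ f S + sum (λ u → when (lookup T u) (marginal ℝ f u S))
        gains S = ≤-trans (monotone (q⊆p∪q S T)) (cover monotone submodular S T)

        losses : ∀ S → sum (λ v → loss f v S) ≤ f S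
        losses S = ≤-trans
          (≤-respˡ (+-identityˡ _) (+-mono-≤ (nonNegative (S ─ ⊤)) (≤-reflexive (sum-cong-≋ everywhere))))
          (peel submodular S ⊤)
          where
          everywhere : ∀ v → loss f v S ≈ when (lookup ⊤ v) (loss f v S)
          everywhere v rewrite lookup-replicate v inside = refl

        -- Peeling L off W leaves a set containing R, and peeling off R one containing L. Together
        -- the two charge every v of W.
        whole-losses : f R + f L + sum dW ≤ f W + f W
        whole-losses = ≤-trans (+-mono-≤ (+-mono-≤ (monotone R⊆W─L) (monotone L⊆W─R))
            (≤-trans (sum-mono-≤ dW≤) (≤-reflexive
              (∑-distrib-+ (λ v → when (lookup L v) (dW v)) (λ v → when (lookup R v) (dW v))))))
          (≤-respˡ (linear (f (W ─ L) ∷ f (W ─ R) ∷ sum (λ v → when (lookup L v) (dW v)) ∷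
                            sum (λ v → when (lookup R v) (dW v)) ∷ [])
                     ((var 0F ⊹ var 2F) ⊹ (var 1F ⊹ var 3F)) ((var 0F ⊹ var 1F) ⊹ (var 2F ⊹ var 3F)) ≡.refl)
            (+-mono-≤ (peel submodular W L) (peel submodular W R)))
          where
          R⊆W─L : R ⊆ W ─ L
          R⊆W─L x∈R = x∈p∧x∉q⇒x∈p─q (right⊆whole x∈R) λ x∈L → disjoint x∈L x∈R
          L⊆W─R : L ⊆ W ─ R
          L⊆W─R x∈L = x∈p∧x∉q⇒x∈p─q (left⊆whole x∈L) (disjoint x∈L)
          when-nonNegative : ∀ b v → 0# ≤ when b (dW v)
          when-nonNegative true  v = loss-nonNegative v W
          when-nonNegative false v = ≤-refl
          dW≤ : ∀ v → dW v ≤ when (lookup L v) (dW v) + when (lookup R v) (dW v)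
          dW≤ v with lookup L v in eqL
          ... | true  = ≤-respˡ (+-identityʳ _) (+-mono-≤ ≤-refl (when-nonNegative (lookup R v) v))
          ... | false with lookup R v in eqR
          ... | true  = ≤-reflexive (sym (+-identityˡ _))
          -- Here v is on neither side, hence outside W, and its loss is at most zero.
          ... | false = ≤-trans (+-cancelʳ-≤ (f (W ∖ v))
              (≤-respˡ (sym (trans (+-comm _ _) (f[S-v]+loss f v W)))
                (≤-respʳ (sym (+-identityˡ _)) (monotone W⊆W∖v))))
              (≤-reflexive (sym (+-identityˡ 0#)))
            where
            W⊆W∖v : W ⊆ W ∖ v
            W⊆W∖v x∈W = x∈p∧x≢y⇒x∈p-y x∈W λ { ≡.refl → [ absent eqL , absent eqR ]′ (covered x∈W) }
              where
              absent : ∀ {S} → lookup S v ≡ false → v ∉ S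
              absent eq v∈S with ≡.trans (≡.sym eq) ([]=⇒lookup v∈S)
              ... | ()

-- Total correctness of programs

lookup-injective : ∀ {S T : Subset n} → lookup S ≗ lookup T → S ≡ T
lookup-injective {S = S} {T = T} eq =
  ≡.trans (≡.sym (tabulate∘lookup S)) (≡.trans (tabulate-cong eq) (tabulate∘lookup T))

[]≔-outside : ∀ (S : Subset n) u → S [ u ]≔ outside ≡ S ∖ u
[]≔-outside (b ∷ S) zero    = ≡.cong (outside ∷_) (≡.sym (p─⊥≡p S))
[]≔-outside (b ∷ S) (suc u) = ≡.cong (b ∷_) ([]≔-outside S u)

[]≔-inside : ∀ (S : Subset n) u → S [ u ]≔ inside ≡ S ∪ ⁅ u ⁆
[]≔-inside (true  ∷ S) zero    = ≡.cong (inside ∷_) (≡.sym (∪-identityʳ S))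
[]≔-inside (false ∷ S) zero    = ≡.cong (inside ∷_) (≡.sym (∪-identityʳ S))
[]≔-inside (true  ∷ S) (suc u) = ≡.cong (true ∷_) ([]≔-inside S u)
[]≔-inside (false ∷ S) (suc u) = ≡.cong (false ∷_) ([]≔-inside S u)

module _ {A : Set} (m : Memory A) where

  ≡ᵇ-refl : ∀ a → (a ≡ᵇ a) ≡ true
  ≡ᵇ-refl a = Equivalence.to T-≡ (ℕ.≡⇒≡ᵇ a a ≡.refl)

  ≢⇒≡ᵇ-false : ∀ {a b} → a ≢ b → (a ≡ᵇ b) ≡ false
  ≢⇒≡ᵇ-false {a} {b} a≢b with a ≡ᵇ b in eq
  ... | false = ≡.refl
  ... | true  = contradiction (ℕ.≡ᵇ⇒≡ a b (Equivalence.from T-≡ eq)) a≢b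

  write-same : ∀ a i v → write m a i v a i ≡ v
  write-same a i v rewrite ≡ᵇ-refl a | ≡ᵇ-refl i = ≡.refl

  write-column : ∀ a {i j} v → j ≢ i → write m a i v a j ≡ m a j
  write-column a v j≢i rewrite ≡ᵇ-refl a | ≢⇒≡ᵇ-false j≢i = ≡.refl

  write-row : ∀ {a b} i v j → b ≢ a → write m a i v b j ≡ m b j
  write-row i v j b≢a rewrite ≢⇒≡ᵇ-false b≢a = ≡.refl

row-write : ∀ (m : Memory ℕ) a (u : Fin n) k →
            row n (write m a (toℕ u) k) a ≡ row n m a [ u ]≔ (0 <ᵇ k)
row-write {n = n} m a u k = lookup-injective pointwise
  where
  pointwise : lookup (row n (write m a (toℕ u) k) a) ≗ lookup (row n m a [ u ]≔ (0 <ᵇ k))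
  pointwise i rewrite lookup∘tabulate (λ i → 0 <ᵇ write m a (toℕ u) k a (toℕ i)) i with i Fin.≟ u
  ... | yes ≡.refl rewrite write-same m a (toℕ i) k = ≡.sym (lookup∘update i (row n m a) (0 <ᵇ k))
  ... | no  i≢u    rewrite write-column m a k (i≢u ∘ Fin.toℕ-injective) =
    ≡.sym (≡.trans (lookup∘update′ i≢u (row n m a) (0 <ᵇ k))
                   (lookup∘tabulate (λ i → 0 <ᵇ m a (toℕ i)) i))

row-write-other : ∀ {n} (m : Memory ℕ) {a b} i k → b ≢ a → row n (write m a i k) b ≡ row n m b
row-write-other m i k b≢a = tabulate-cong λ j → ≡.cong (0 <ᵇ_) (write-row m i k (toℕ j) b≢a)

-- Rows 0 to 9 hold sets; the counter of a loop nested inside d others is in row 10 + d.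

counter : ℕ → NatExp
counter d = N[ lit (10 ℕ.+ d) , lit 0 ]

for : ℕ → NatExp → Program → Program
for d bound body =
  N[ lit (10 ℕ.+ d) , lit 0 ]≔ lit 0 ︔
  while (counter d ⊕ lit 1 ≤ᴺ bound)
    (body ︔ N[ lit (10 ℕ.+ d) , lit 0 ]≔ (counter d ⊕ lit 1))

-- Each turn pays the body, 7 plus the cost of the bound for the test, and 8 for the increment. The
-- remainder is 4 for the initial assignment and the final failing test.
forTime : NatExp → ℕ → ℕ → ℕ
forTime bound k t = k ℕ.* (15 ℕ.+ costᴺ bound ℕ.+ t) ℕ.+ (11 ℕ.+ costᴺ bound)

set : Fin 10 → NatExp → NatExp → Program
set a i e = N[ lit (toℕ a) , i ]≔ e

copy : ℕ → Fin 10 → Fin 10 → Program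
copy d a b = for d size (set b (counter d) N[ lit (toℕ a) , counter d ])

copyTime : ℕ → ℕ
copyTime n = forTime size n 10

Sets : ℕ → Set
Sets n = Fin 10 → Subset n

_[_↦_] : Sets n → Fin 10 → Subset n → Sets n
(ρ [ a ↦ S ]) b = if does (b Fin.≟ a) then S else ρ b

module Logic (ℝ : RealNumbers) {n} (f : SetFunction ℝ n)
             {Indep : Subset n → Set} (indep? : Decidable Indep) where
  open Execution ℝ f indep?
  open State

  Counters : List ℕ → Memory ℕ → Set
  Counters []      m = Unit
  Counters (i ∷ κ) m = m (10 ℕ.+ length κ) 0 ≡ i × Counters κ m

  -- The counters in `κ` are those of the enclosing loops, innermost first. Real memory and the
  -- counters of finished loops are left arbitrary, so no loop has to clean up after itself.
  record Holds (ρ : Sets n) (κ : List ℕ) (s : State ℝ) : Set where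
    constructor holds
    field
      rows     : ∀ a → row n (nats s) (toℕ a) ≡ ρ a
      counters : Counters κ (nats s)

  open Holds

  Counters-frame : ∀ κ {m m′ : Memory ℕ} → (∀ {d} → d < length κ → m′ (10 ℕ.+ d) 0 ≡ m (10 ℕ.+ d) 0) →
                   Counters κ m → Counters κ m′
  Counters-frame []      same _        = tt
  Counters-frame (i ∷ κ) same (eq , c) =
    ≡.trans (same ℕ.≤-refl) eq , Counters-frame κ (same ∘ ℕ.m≤n⇒m≤1+n) c

  -- A total-correctness triple in weakest-precondition form. `t` is only an upper bound, as
  -- branches differ in cost; `κ` is the same before and after, so enclosing counters survive.
  wp : Program → ℕ → List ℕ → (Sets n → Set) → Sets n → Set
  wp p t κ Q ρ = ∀ s → Holds ρ κ s → ∃ λ s′ → ∃ λ t′ → ∃ λ ρ′ →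
    s ⊢ p ⇓[ t′ ] s′ × t′ ℕ.≤ t × Holds ρ′ κ s′ × Q ρ′

  private variable
    p q : Program
    t t′ : ℕ
    κ : List ℕ
    P Q : Sets n → Set
    ρ : Sets n

  wp-mono : (∀ {ρ} → P ρ → Q ρ) → wp p t κ P ρ → wp p t κ Q ρ
  wp-mono P⇒Q run s h with run s h
  ... | s′ , t′ , ρ′ , r , le , h′ , pρ′ = s′ , t′ , ρ′ , r , le , h′ , P⇒Q pρ′

  -- `Holds` sees the family of sets only pointwise, so a pointwise equal one may take its place
  -- without function extensionality.
  wp-≗ : ∀ {ρ′} → wp p t κ (_≗ ρ′) ρ → Q ρ′ → wp p t κ Q ρ
  wp-≗ {ρ′ = ρ′} run qρ′ s h with run s h
  ... | s′ , t′ , ρ″ , r , le , holds rows counters , ρ″≗ρ′ =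
    s′ , t′ , ρ′ , r , le , holds (λ a → ≡.trans (rows a) (ρ″≗ρ′ a)) counters , qρ′

  wp-skip : Q ρ → wp skip 1 κ Q ρ
  wp-skip qρ s h = s , 1 , _ , run-skip , ℕ.≤-refl , h , qρ

  wp-seq : wp p t κ (wp q t′ κ Q) ρ → wp (p ︔ q) (t ℕ.+ t′) κ Q ρ
  wp-seq run s h with run s h
  ... | s′ , t₁ , ρ′ , r , le , h′ , run′ with run′ s′ h′
  ... | s″ , t₂ , ρ″ , r′ , le′ , h″ , qρ″ =
    s″ , t₁ ℕ.+ t₂ , ρ″ , run-seq r r′ , ℕ.+-mono-≤ le le′ , h″ , qρ″

  -- The sum of the times of both branches bounds either one and, unlike their maximum, remains a
  -- polynomial expression.
  wp-cond : ∀ {b} c → (∀ s → Holds ρ κ s → evalᵀ s b ≡ c) →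
            (c ≡ true → wp p t κ Q ρ) → (c ≡ false → wp q t′ κ Q ρ) →
            wp (cond b p q) (suc (costᵀ b ℕ.+ (t ℕ.+ t′))) κ Q ρ
  wp-cond {b = b} true  eval then else s h with then ≡.refl s h
  ... | s′ , t₁ , ρ′ , r , le , h′ , qρ′ = s′ , _ , ρ′ , run-then (eval s h) r ,
    ℕ.s≤s (ℕ.+-monoʳ-≤ (costᵀ b) (ℕ.m≤n⇒m≤n+o _ le)) , h′ , qρ′
  wp-cond {b = b} false eval then else s h with else ≡.refl s h
  ... | s′ , t₁ , ρ′ , r , le , h′ , qρ′ = s′ , _ , ρ′ , run-else (eval s h) r ,
    ℕ.s≤s (ℕ.+-monoʳ-≤ (costᵀ b) (ℕ.m≤n⇒m≤o+n _ le)) , h′ , qρ′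

  toℕ≢10+ : ∀ (a : Fin 10) d → 10 ℕ.+ d ≢ toℕ a
  toℕ≢10+ a d eq = ℕ.<⇒≱ (Fin.toℕ<n a) (ℕ.≤-trans (ℕ.m≤m+n 10 d) (ℕ.≤-reflexive eq))

  wp-set : ∀ a (u : Fin n) {i e b} →
    (∀ s → Holds ρ κ s → evalᴺ s i ≡ toℕ u) → (∀ s → Holds ρ κ s → (0 <ᵇ evalᴺ s e) ≡ b) →
    ∀ {S} → ρ a [ u ]≔ b ≡ S → Q (ρ [ a ↦ S ]) →
    wp (set a i e) (suc (suc (costᴺ i ℕ.+ costᴺ e))) κ Q ρ
  wp-set {ρ = ρ} {κ = κ} a u {i} {e} index bit {S} eq qρ s h =
    setᴺ s (lit (toℕ a)) i e , _ , ρ [ a ↦ S ] , run-setᴺ , ℕ.≤-refl , holds rows′ counters′ , qρ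
    where
    k = evalᴺ s e
    rows′ : ∀ b → row n (write (nats s) (toℕ a) (evalᴺ s i) k) (toℕ b) ≡ (ρ [ a ↦ S ]) b
    rows′ b with b Fin.≟ a
    ... | yes ≡.refl rewrite index s h =
      ≡.trans (row-write (nats s) (toℕ b) u k)
        (≡.trans (≡.cong₂ (λ S b → S [ u ]≔ b) (rows h b) (bit s h)) eq)
    ... | no b≢a = ≡.trans (row-write-other (nats s) _ k (b≢a ∘ Fin.toℕ-injective)) (rows h b)
    counters′ : Counters κ (write (nats s) (toℕ a) (evalᴺ s i) k)
    counters′ = Counters-frame κ (λ {d} _ → write-row (nats s) (evalᴺ s i) k 0 (toℕ≢10+ a d)) (counters h)

  set-counter : ∀ {s} k → Holds ρ κ s →
    Holds ρ (k ∷ κ) ⟨ write (nats s) (10 ℕ.+ length κ) 0 k , reals s ⟩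
  set-counter {κ = κ} {s} k h = holds
    (λ a → ≡.trans (row-write-other (nats s) 0 k (toℕ≢10+ a (length κ) ∘ ≡.sym)) (rows h a))
    (write-same (nats s) _ 0 k ,
     Counters-frame κ (λ d<κ → write-row (nats s) 0 k 0 (ℕ.<⇒≢ d<κ ∘ ℕ.+-cancelˡ-≡ 10 _ _)) (counters h))

  leave : ∀ {i s} → Holds ρ (i ∷ κ) s → Holds ρ κ s
  leave (holds rows (_ , counters)) = holds rows counters

  module _ {k : ℕ} {bound : NatExp} (bound≡ : ∀ s → evalᴺ s bound ≡ k)
           (I : ℕ → Sets n → Set) {body : Program} {κ : List ℕ} {t : ℕ}
           (step : ∀ i ρ → i < k → I i ρ → wp body t (i ∷ κ) (I (suc i)) ρ) where

    private
      d = length κ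
      test : Test
      test = counter d ⊕ lit 1 ≤ᴺ bound
      increment : Program
      increment = N[ lit (10 ℕ.+ d) , lit 0 ]≔ (counter d ⊕ lit 1)
      incremented : State ℝ → State ℝ
      incremented s = setᴺ s (lit (10 ℕ.+ d)) (lit 0) (counter d ⊕ lit 1)
      turn = 15 ℕ.+ costᴺ bound ℕ.+ t
      c = costᴺ bound

      evaluate : ∀ {i s} → Holds ρ (i ∷ κ) s → evalᵀ s test ≡ (suc i ≤ᵇ k)
      evaluate {i = i} {s} h = ≡.cong₂ _≤ᵇ_
        (≡.trans (≡.cong (ℕ._+ 1) (proj₁ (counters h))) (ℕ.+-comm i 1)) (bound≡ s)

      turn-≤ : ∀ {t₁ t₂ m} → t₁ ℕ.≤ t → t₂ ℕ.≤ m ℕ.* turn ℕ.+ (7 ℕ.+ c) →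
               suc (costᵀ test ℕ.+ (t₁ ℕ.+ 8) ℕ.+ t₂) ℕ.≤ suc m ℕ.* turn ℕ.+ (7 ℕ.+ c)
      turn-≤ {t₁} {t₂} {m} le₁ le₂ = begin
        suc (costᵀ test ℕ.+ (t₁ ℕ.+ 8) ℕ.+ t₂)
          ≡⟨⟩
        7 ℕ.+ (c ℕ.+ (t₁ ℕ.+ 8) ℕ.+ t₂)
          ≤⟨ ℕ.+-monoʳ-≤ 7 (ℕ.+-mono-≤ (ℕ.+-monoʳ-≤ c (ℕ.+-monoˡ-≤ 8 le₁)) le₂) ⟩
        7 ℕ.+ (c ℕ.+ (t ℕ.+ 8) ℕ.+ (m ℕ.* turn ℕ.+ (7 ℕ.+ c)))
          ≡⟨ ≡.cong (λ x → 7 ℕ.+ (x ℕ.+ (m ℕ.* turn ℕ.+ (7 ℕ.+ c))))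
               (≡.trans (≡.sym (ℕ.+-assoc c t 8)) (ℕ.+-comm (c ℕ.+ t) 8)) ⟩
        turn ℕ.+ (m ℕ.* turn ℕ.+ (7 ℕ.+ c))
          ≡⟨ ≡.sym (ℕ.+-assoc turn (m ℕ.* turn) (7 ℕ.+ c)) ⟩
        suc m ℕ.* turn ℕ.+ (7 ℕ.+ c) ∎
        where open ℕ.≤-Reasoning

      -- Induction on the number m of turns still to come. The body preserves `i ∷ κ`, so the
      -- counter is still i when it is incremented.
      loop : ∀ m i ρ → m ℕ.+ i ≡ k → I i ρ → ∀ s → Holds ρ (i ∷ κ) s →
             ∃ λ s′ → ∃ λ t′ → ∃ λ ρ′ → s ⊢ while test (body ︔ increment) ⇓[ t′ ] s′ ×
             t′ ℕ.≤ m ℕ.* turn ℕ.+ (7 ℕ.+ c) × Holds ρ′ κ s′ × I k ρ′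
      loop zero i ρ ≡.refl inv s h =
        s , _ , ρ , run-stop (≡.trans (evaluate h) (1+i≰i i)) , ℕ.≤-refl , leave h , inv
        where
        1+i≰i : ∀ i → (i <ᵇ i) ≡ false
        1+i≰i zero    = ≡.refl
        1+i≰i (suc i) = 1+i≰i i
      loop (suc m) i ρ eq inv s h with step i ρ i<k inv s h
        where
        i<k : i < k
        i<k = ℕ.≤-trans (ℕ.s≤s (ℕ.m≤n+m i m)) (ℕ.≤-reflexive eq)
      ... | s₁ , t₁ , ρ₁ , r₁ , le₁ , h₁ , inv₁
        with loop m (suc i) ρ₁ (≡.trans (ℕ.+-suc m i) eq) inv₁ (incremented s₁)
               (≡.subst (λ j → Holds ρ₁ (j ∷ κ) (incremented s₁))
                 (≡.trans (≡.cong (ℕ._+ 1) (proj₁ (counters h₁))) (ℕ.+-comm i 1))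
                 (set-counter _ (leave h₁)))
      ... | s₂ , t₂ , ρ₂ , r₂ , le₂ , h₂ , inv₂ =
        s₂ , _ , ρ₂ , run-loop continue (run-seq r₁ run-setᴺ) r₂ , turn-≤ {m = m} le₁ le₂ , h₂ , inv₂
        where
        continue : evalᵀ s test ≡ true
        continue = ≡.trans (evaluate h) (Equivalence.to T-≡
          (ℕ.≤⇒≤ᵇ (ℕ.≤-trans (ℕ.s≤s (ℕ.m≤n+m i m)) (ℕ.≤-reflexive eq))))

    wp-for : I 0 ρ → wp (for (length κ) bound body) (forTime bound k t) κ (I k) ρ
    wp-for inv s h with loop k 0 _ (ℕ.+-identityʳ k) inv _ (set-counter 0 h)
    ... | s′ , t′ , ρ′ , r , le , h′ , inv′ =
      s′ , _ , ρ′ , run-seq run-setᴺ r ,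
      ℕ.≤-trans (ℕ.+-monoʳ-≤ 4 le) (ℕ.≤-reflexive shift) , h′ , inv′
      where
      shift : 4 ℕ.+ (k ℕ.* turn ℕ.+ (7 ℕ.+ c)) ≡ forTime bound k t
      shift = ≡.trans (ℕ.+-comm 4 _) (≡.trans (ℕ.+-assoc (k ℕ.* turn) (7 ℕ.+ c) 4)
        (≡.cong (k ℕ.* turn ℕ.+_) (ℕ.+-comm (7 ℕ.+ c) 4)))

  wp-copy : ∀ a b → a ≢ b → Q (ρ [ b ↦ ρ a ]) → wp (copy (length κ) a b) (copyTime n) κ Q ρ
  wp-copy {ρ = ρ} {κ = κ} a b a≢b qρ =
    wp-≗ (wp-mono finished (wp-for (λ _ → ≡.refl) Copied step ((λ _ ()) , λ _ _ → ≡.refl))) qρ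
    where
    Copied : ℕ → Sets n → Set
    Copied i ρ′ = (∀ j → toℕ j < i → lookup (ρ′ b) j ≡ lookup (ρ a) j) × (∀ c → c ≢ b → ρ′ c ≡ ρ c)

    finished : ∀ {ρ′} → Copied n ρ′ → ρ′ ≗ ρ [ b ↦ ρ a ]
    finished (copied , same) c with c Fin.≟ b
    ... | yes ≡.refl = lookup-injective λ j → copied j (Fin.toℕ<n j)
    ... | no  c≢b    = same c c≢b

    step : ∀ i ρ′ → i < n → Copied i ρ′ → wp _ 10 (i ∷ κ) (Copied (suc i)) ρ′
    step i ρ′ i<n (copied , same) = wp-set b w index bit ≡.refl (copied′ , same′)
      where
      w = fromℕ< i<n
      X = ρ′ b [ w ]≔ lookup (ρ a) w

      index : ∀ s → Holds ρ′ (i ∷ κ) s → nats s (10 ℕ.+ length κ) 0 ≡ toℕ w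
      index s h = ≡.trans (proj₁ (counters h)) (≡.sym (Fin.toℕ-fromℕ< i<n))

      bit : ∀ s → Holds ρ′ (i ∷ κ) s →
            (0 <ᵇ nats s (toℕ a) (nats s (10 ℕ.+ length κ) 0)) ≡ lookup (ρ a) w
      bit s h = begin
        (0 <ᵇ nats s (toℕ a) (nats s (10 ℕ.+ length κ) 0))
          ≡⟨ ≡.cong (λ j → 0 <ᵇ nats s (toℕ a) j) (index s h) ⟩
        (0 <ᵇ nats s (toℕ a) (toℕ w))
          ≡⟨ lookup∘tabulate (λ j → 0 <ᵇ nats s (toℕ a) (toℕ j)) w ⟨
        lookup (row n (nats s) (toℕ a)) w
          ≡⟨ ≡.cong (λ S → lookup S w) (≡.trans (rows h a) (same a a≢b)) ⟩
        lookup (ρ a) w ∎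
        where open ≡.≡-Reasoning

      copied′ : ∀ j → toℕ j < suc i → lookup ((ρ′ [ b ↦ X ]) b) j ≡ lookup (ρ a) j
      copied′ j j<1+i rewrite dec-true (b Fin.≟ b) ≡.refl with j Fin.≟ w
      ... | yes ≡.refl = lookup∘update w (ρ′ b) _
      ... | no  j≢w    = ≡.trans (lookup∘update′ j≢w (ρ′ b) _) (copied j (ℕ.≤∧≢⇒< (ℕ.s≤s⁻¹ j<1+i)
        λ j≡i → j≢w (Fin.toℕ-injective (≡.trans j≡i (≡.sym (Fin.toℕ-fromℕ< i<n))))))

      same′ : ∀ c → c ≢ b → (ρ′ [ b ↦ X ]) c ≡ ρ c
      same′ c c≢b rewrite dec-false (c Fin.≟ b) c≢b = same c c≢b

  wp-remove : ∀ a (u : Fin n) {i} → (∀ s → Holds ρ κ s → evalᴺ s i ≡ toℕ u) →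
    Q (ρ [ a ↦ ρ a ∖ u ]) → wp (set a i (lit 0)) (suc (suc (costᴺ i ℕ.+ 1))) κ Q ρ
  wp-remove {ρ = ρ} a u {i} index = wp-set a u {i} {lit 0} index (λ _ _ → ≡.refl) ([]≔-outside (ρ a) u)

  wp-insert : ∀ a (u : Fin n) {i} → (∀ s → Holds ρ κ s → evalᴺ s i ≡ toℕ u) →
    Q (ρ [ a ↦ ρ a ∪ ⁅ u ⁆ ]) → wp (set a i (lit 1)) (suc (suc (costᴺ i ℕ.+ 1))) κ Q ρ
  wp-insert {ρ = ρ} a u {i} index = wp-set a u {i} {lit 1} index (λ _ _ → ≡.refl) ([]≔-inside (ρ a) u)

-- The algorithm

objectiveᴱ : ℕ → ℕ → ℕ → RealExp
objectiveᴱ a b c = lit 2 ⊠ value (lit a) ⊞ lit 2 ⊠ value (lit b) ⊞ lit 3 ⊠ value (lit c)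

-- Unrolled into additions, since the machine does not multiply natural numbers.
times : ℕ → NatExp → NatExp
times zero    e = lit 0
times (suc k) e = e ⊕ times k e

-- Row 0 holds the output, rows 1-3 the current configuration, rows 4-6 a
-- candidate and rows 7-9 the best candidate of the round; the loop counters
-- are the round, the inserted and the removed element.

data Direction : Set where
  leftward rightward : Direction

into out-of : Direction → Fin 10
into   leftward  = 4F
into   rightward = 5F
out-of leftward  = 5F
out-of rightward = 4F

-- The removed element is cleared before the inserted one is set, so that u stays in when the two
-- coincide.
build : Direction → Program
build δ =
  copy 3 1F 4F ︔ copy 3 2F 5F ︔ copy 3 3F 6F ︔
  set (into δ) (counter 2) (lit 0) ︔ set (into δ) (counter 1) (lit 1) ︔
  set (out-of δ) (counter 2) (lit 0) ︔ set (out-of δ) (counter 1) (lit 0) ︔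
  set 6F (counter 2) (lit 0) ︔ set 6F (counter 1) (lit 1)

better : Test
better = independent (lit 6) and (objectiveᴱ 7 8 9 ≤ᴿ objectiveᴱ 4 5 6)

try : Direction → Program
try δ = build δ ︔
  cond better (copy 3 4F 7F ︔ copy 3 5F 8F ︔ copy 3 6F 9F) skip

scan : Program
scan = for 1 size (for 2 size (try leftward ︔ try rightward))

-- The copies leave rows 7-9 equal to rows 1-3, so the next scan starts with the current
-- configuration as incumbent and needs no reset. The output is chosen by f, not by the objective.
round : Program
round = scan ︔ copy 1 7F 1F ︔ copy 1 8F 2F ︔ copy 1 9F 3F ︔
  cond (value (lit 0) ≤ᴿ value (lit 3)) (copy 1 3F 0F) skip

rounds : NatExp
rounds = times 28 size ⊕ lit 1

algorithm : Program
algorithm = for 0 rounds round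

-- In `buildTime`, 36 is six assignments of cost 6; in `roundTime`, 5 is the comparison of two
-- values of f.
buildTime tryTime scanTime roundTime algorithmTime : ℕ → ℕ
buildTime n = copyTime n ℕ.+ (copyTime n ℕ.+ (copyTime n ℕ.+ 36))
tryTime n = buildTime n ℕ.+
  suc (costᵀ better ℕ.+ ((copyTime n ℕ.+ (copyTime n ℕ.+ copyTime n)) ℕ.+ 1))
scanTime n = forTime size n (forTime size n (tryTime n ℕ.+ tryTime n))
roundTime n = scanTime n ℕ.+ (copyTime n ℕ.+ (copyTime n ℕ.+ (copyTime n ℕ.+
  suc (5 ℕ.+ (copyTime n ℕ.+ 1)))))
algorithmTime n = forTime rounds (28 ℕ.* n ℕ.+ 1) (roundTime n)

candidate : Direction → Fin n → Fin n → Config n → Config n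
candidate leftward  u v Z = move u v Z
candidate rightward u v Z = mirror (move u v (mirror Z))

candidate-split : ∀ δ (u v : Fin n) {Z} → Split Z → Split (candidate δ u v Z)
candidate-split leftward  u v split = move-split u v split
candidate-split rightward u v split = mirror-split (move-split u v (mirror-split split))

candidate-whole : ∀ δ (u v : Fin n) Z →
                  Config.whole (candidate δ u v Z) ≡ (Config.whole Z ∖ v) ∪ ⁅ u ⁆
candidate-whole leftward  u v Z = ≡.refl
candidate-whole rightward u v Z = ≡.refl

output : Sets n → Subset n
output ρ = ρ 0F

current trial incumbent : Sets n → Config n
current   ρ = ⟪ ρ 1F , ρ 2F , ρ 3F ⟫
trial     ρ = ⟪ ρ 4F , ρ 5F , ρ 6F ⟫
incumbent ρ = ⟪ ρ 7F , ρ 8F , ρ 9F ⟫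

does-true : {A : Set} (A? : Dec A) → does A? ≡ true → A
does-true (yes a) _ = a

does-false : {A : Set} (A? : Dec A) → does A? ≡ false → ¬ A
does-false (no ¬a) _ = ¬a

-- Correctness of the algorithm

module Correctness (ℝ : RealNumbers) {n} (f : SetFunction ℝ n)
                   (nonNegative : NonNegative ℝ f) (monotone : Monotone ℝ f)
                   (submodular : Submodular ℝ f)
                   (M : Matroid n) (indep? : Decidable (Independent M)) where
  open OrderedField ℝ
  open LocalSearch ℝ f
  open Execution ℝ f indep?
  open Logic ℝ f indep?
  open Holds
  open Config

  -- The value that the machine computes, by multiplication of reals, while `objective` uses the
  -- repeated addition that `linear` understands.
  score : Config n → Carrier
  score Z = fromℕ 2 * f (left Z) + fromℕ 2 * f (right Z) + fromℕ 3 * f (whole Z)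

  score≈objective : ∀ Z → score Z ≈ objective Z
  score≈objective Z = +-cong (+-cong (fromℕ-* 2 _) (fromℕ-* 2 _)) (fromℕ-* 3 _)

  objective-mirror : ∀ Z → objective (mirror Z) ≈ objective Z
  objective-mirror Z = +-congʳ (+-comm _ _)

  private variable
    ρ : Sets n
    Q : Sets n → Set

  Seen : Set₁
  Seen = Config n → Set

  -- Loop invariant, with `seen` the candidates tried so far. `dominates` is limited to independent
  -- ones, as the others are rejected whatever their objective.
  record Scan (Z : Config n) (X : Subset n) (seen : Seen) (ρ : Sets n) : Set where
    field
      current≡  : current ρ ≡ Z
      output≡   : output ρ ≡ X
      split     : Split (incumbent ρ)
      feasible  : Independent M (whole (incumbent ρ))
      no-worse  : objective Z ≤ objective (incumbent ρ)
      dominates : ∀ Z′ → seen Z′ → Independent M (whole Z′) →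
                  objective Z′ ≤ objective (incumbent ρ)

  restrict : ∀ {Z X} {seen seen′ : Seen} → (∀ {Z′} → seen′ Z′ → seen Z′) →
             Scan Z X seen ρ → Scan Z X seen′ ρ
  restrict sub scanned = record
    { Scan scanned hiding (dominates) ; dominates = λ Z′ → Scan.dominates scanned Z′ ∘ sub }

  module _ (u v : Fin n) {i j k : ℕ} (i≡v : i ≡ toℕ v) (j≡u : j ≡ toℕ u) where

    private
      κ : List ℕ
      κ = i ∷ j ∷ k ∷ []

      inserted : ∀ {ρ} s → Holds ρ κ s → evalᴺ s (counter 1) ≡ toℕ u
      inserted s h = ≡.trans (proj₁ (proj₂ (counters h))) j≡u

      removed : ∀ {ρ} s → Holds ρ κ s → evalᴺ s (counter 2) ≡ toℕ v
      removed s h = ≡.trans (proj₁ (counters h)) i≡v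

    record Built (δ : Direction) (ρ ρ′ : Sets n) : Set where
      field
        trial≡     : trial ρ′ ≡ candidate δ u v (current ρ)
        current≡   : current ρ′ ≡ current ρ
        incumbent≡ : incumbent ρ′ ≡ incumbent ρ
        output≡    : output ρ′ ≡ output ρ

    -- Once δ is known all row numbers are closed and the updates compute, so every field of `Built`
    -- is `≡.refl`; hence one clause per direction.
    wp-build : ∀ δ → (∀ ρ′ → Built δ ρ ρ′ → Q ρ′) → wp (build δ) (buildTime n) κ Q ρ
    wp-build {ρ = ρ} leftward built =
      wp-seq (wp-copy 1F 4F (λ ()) (wp-seq (wp-copy 2F 5F (λ ()) (wp-seq (wp-copy 3F 6F (λ ())
      (wp-seq (wp-remove 4F v removed (wp-seq (wp-insert 4F u inserted
      (wp-seq (wp-remove 5F v removed (wp-seq (wp-remove 5F u inserted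
      (wp-seq (wp-remove 6F v removed (wp-insert 6F u inserted
        (built _ record { trial≡ = ≡.refl ; current≡ = ≡.refl ; incumbent≡ = ≡.refl ; output≡ = ≡.refl }
        )))))))))))))))))
    wp-build {ρ = ρ} rightward built =
      wp-seq (wp-copy 1F 4F (λ ()) (wp-seq (wp-copy 2F 5F (λ ()) (wp-seq (wp-copy 3F 6F (λ ())
      (wp-seq (wp-remove 5F v removed (wp-seq (wp-insert 5F u inserted
      (wp-seq (wp-remove 4F v removed (wp-seq (wp-remove 4F u inserted
      (wp-seq (wp-remove 6F v removed (wp-insert 6F u inserted
        (built _ record { trial≡ = ≡.refl ; current≡ = ≡.refl ; incumbent≡ = ≡.refl ; output≡ = ≡.refl }
        )))))))))))))))))

    wp-try : ∀ δ {Z X} {seen : Seen} → Split Z → Scan Z X seen ρ →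
      wp (try δ) (tryTime n) κ (Scan Z X (λ Z′ → Z′ ≡ candidate δ u v Z ⊎ seen Z′)) ρ
    wp-try {ρ = ρ} δ {Z} {X} {seen} split-Z scanned = wp-seq (wp-build δ decide)
      where
      open Scan scanned
      now : Seen
      now Z′ = Z′ ≡ candidate δ u v Z ⊎ seen Z′

      module _ (ρ′ : Sets n) (built : Built δ ρ ρ′) where
        module B = Built built

        trial≡ : trial ρ′ ≡ candidate δ u v Z
        trial≡ = ≡.trans B.trial≡ (≡.cong (candidate δ u v) current≡)

        better? : Dec (Independent M (ρ′ 6F) × score (incumbent ρ′) ≤ score (trial ρ′))
        better? = indep? (ρ′ 6F) ×-dec (score (incumbent ρ′) ≤? score (trial ρ′))

        evaluate : ∀ s → Holds ρ′ κ s → evalᵀ s better ≡ does better?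
        evaluate s h rewrite rows h 4F | rows h 5F | rows h 6F | rows h 7F | rows h 8F | rows h 9F = ≡.refl

        incumbent-≤ : ∀ {Z′} → objective Z′ ≤ objective (incumbent ρ) →
                      objective Z′ ≤ objective (incumbent ρ′)
        incumbent-≤ {Z′} = ≡.subst (λ B → objective Z′ ≤ objective B) (≡.sym B.incumbent≡)

        score-≤ : ∀ {Z₁ Z₂} → score Z₁ ≤ score Z₂ → objective Z₁ ≤ objective Z₂
        score-≤ le = ≤-respˡ (score≈objective _) (≤-respʳ (score≈objective _) le)

        accepted : does better? ≡ true → Scan Z X now (((ρ′ [ 7F ↦ ρ′ 4F ]) [ 8F ↦ ρ′ 5F ]) [ 9F ↦ ρ′ 6F ])
        accepted yes-better = record
          { current≡  = ≡.trans B.current≡ current≡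
          ; output≡   = ≡.trans B.output≡ output≡
          ; split     = ≡.subst Split (≡.sym trial≡) (candidate-split δ u v split-Z)
          ; feasible  = proj₁ improved
          ; no-worse  = ≤-trans (incumbent-≤ no-worse) (score-≤ (proj₂ improved))
          ; dominates = λ where
              Z′ (inj₁ eq) _  → ≤-reflexive (reflexive (≡.cong objective (≡.trans eq (≡.sym trial≡))))
              Z′ (inj₂ old) i → ≤-trans (incumbent-≤ (dominates Z′ old i)) (score-≤ (proj₂ improved))
          }
          where improved = does-true better? yes-better

        rejected : does better? ≡ false → Scan Z X now ρ′
        rejected not-better = record
          { current≡  = ≡.trans B.current≡ current≡
          ; output≡   = ≡.trans B.output≡ output≡
          ; split     = ≡.subst Split (≡.sym B.incumbent≡) split
          ; feasible  = ≡.subst (Independent M ∘ whole) (≡.sym B.incumbent≡) feasible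
          ; no-worse  = incumbent-≤ no-worse
          ; dominates = λ where
              Z′ (inj₁ eq) i  → new (≡.trans eq (≡.sym trial≡)) i
              Z′ (inj₂ old) i → incumbent-≤ (dominates Z′ old i)
          }
          where
          new : ∀ {Z′} → Z′ ≡ trial ρ′ → Independent M (whole Z′) → objective Z′ ≤ objective (incumbent ρ′)
          new ≡.refl i with total (score (trial ρ′)) (score (incumbent ρ′))
          ... | inj₁ le = score-≤ le
          ... | inj₂ le = contradiction (i , le) (does-false better? not-better)

        decide : wp _ _ κ (Scan Z X now) ρ′
        decide = wp-cond (does better?) evaluate
          (λ eq → wp-seq (wp-copy 4F 7F (λ ()) (wp-seq (wp-copy 5F 8F (λ ())
            (wp-copy 6F 9F (λ ()) (accepted eq))))))
          (λ eq → wp-skip (rejected eq))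

  wp-scan : ∀ {Z X k} → Split Z → Scan Z X (λ _ → Absurd) ρ →
    wp scan (scanTime n) (k ∷ [])
      (Scan Z X (λ Z′ → ∃ λ δ → ∃ λ u → ∃ λ v → Z′ ≡ candidate δ u v Z)) ρ
  wp-scan {Z = Z} {X} {k} split-Z scanned =
    wp-mono (restrict λ { (δ , u , v , eq) → δ , u , v , Fin.toℕ<n u , eq })
      (wp-for (λ _ → ≡.refl) (Scan Z X ∘ Before) outer (restrict (λ { (_ , _ , _ , () , _) }) scanned))
    where
    Before : ℕ → Seen
    Before j Z′ = ∃ λ δ → ∃ λ u → ∃ λ v → toℕ u < j × Z′ ≡ candidate δ u v Z

    module _ j ρ (j<n : j < n) (scanned : Scan Z X (Before j) ρ) where
      p = fromℕ< j<n

      Before′ : ℕ → Seen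
      Before′ i Z′ = Before j Z′ ⊎ ∃ λ δ → ∃ λ v → toℕ v < i × Z′ ≡ candidate δ p v Z

      extended : ∀ {Z′} → Before (suc j) Z′ → Before′ n Z′
      extended (δ , u′ , v , u′<1+j , eq) with toℕ u′ ℕ.≟ j
      ... | no  u′≢j = inj₁ (δ , u′ , v , ℕ.≤∧≢⇒< (ℕ.s≤s⁻¹ u′<1+j) u′≢j , eq)
      ... | yes ≡.refl = inj₂ (δ , v , Fin.toℕ<n v ,
        ≡.trans eq (≡.cong (λ w → candidate δ w v Z) (≡.sym (Fin.fromℕ<-toℕ u′ j<n))))

      inner : ∀ i ρ′ → i < n → Scan Z X (Before′ i) ρ′ →
              wp (try leftward ︔ try rightward) (tryTime n ℕ.+ tryTime n) (i ∷ j ∷ k ∷ [])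
                 (Scan Z X (Before′ (suc i))) ρ′
      inner i ρ′ i<n scanned′ = wp-seq (wp-mono
          (λ scanned″ → wp-mono (restrict extended′) (wp-try p q i≡q j≡p rightward split-Z scanned″))
          (wp-try p q i≡q j≡p leftward split-Z scanned′))
        where
        q = fromℕ< i<n
        i≡q : i ≡ toℕ q
        i≡q = ≡.sym (Fin.toℕ-fromℕ< i<n)
        j≡p : j ≡ toℕ p
        j≡p = ≡.sym (Fin.toℕ-fromℕ< j<n)
        extended′ : ∀ {Z′} → Before′ (suc i) Z′ →
          Z′ ≡ candidate rightward p q Z ⊎ Z′ ≡ candidate leftward p q Z ⊎ Before′ i Z′
        extended′ (inj₁ before) = inj₂ (inj₂ (inj₁ before))
        extended′ (inj₂ (δ , v′ , v′<1+i , eq)) with toℕ v′ ℕ.≟ i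
        ... | no  v′≢i = inj₂ (inj₂ (inj₂ (δ , v′ , ℕ.≤∧≢⇒< (ℕ.s≤s⁻¹ v′<1+i) v′≢i , eq)))
        ... | yes ≡.refl with ≡.trans eq (≡.cong (λ w → candidate δ p w Z) (≡.sym (Fin.fromℕ<-toℕ v′ i<n)))
        extended′ (inj₂ (leftward  , _)) | yes ≡.refl | eq = inj₂ (inj₁ eq)
        extended′ (inj₂ (rightward , _)) | yes ≡.refl | eq = inj₁ eq

      outer : wp (for 2 size (try leftward ︔ try rightward))
                 (forTime size n (tryTime n ℕ.+ tryTime n)) (j ∷ k ∷ [])
                 (Scan Z X (Before (suc j))) ρ
      outer = wp-mono (restrict extended) (wp-for (λ _ → ≡.refl) (Scan Z X ∘ Before′) inner
        (restrict (λ { (inj₁ before) → before ; (inj₂ (_ , _ , () , _)) }) scanned))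

  module _ (T : Subset n) (iT : Independent M T) where

    -- Until the output is good enough, every round raises the objective by
    -- at least f T / 4n.
    record Round (k : ℕ) (ρ : Sets n) : Set where
      field
        split           : Split (current ρ)
        feasible        : Independent M (whole (current ρ))
        incumbent≡      : incumbent ρ ≡ current ρ
        output-feasible : Independent M (output ρ)
        output-≥        : f (whole (current ρ)) ≤ f (output ρ)
        potential       : 19 · f T ≤ 36 · f (output ρ) ⊎
                          k · f T ≤ 2 · n · 2 · objective (current ρ)

    wp-round : ∀ k ρ → Round k ρ → wp round (roundTime n) (k ∷ []) (Round (suc k)) ρ
    wp-round k ρ start = wp-seq (wp-mono after (wp-scan split scanned))
      where
      open Round start
      Z = current ρ
      O = output ρ

      scanned : Scan Z O (λ _ → Absurd) ρ
      scanned = record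
        { current≡  = ≡.refl
        ; output≡   = ≡.refl
        ; split     = ≡.subst Split (≡.sym incumbent≡) split
        ; feasible  = ≡.subst (Independent M ∘ whole) (≡.sym incumbent≡) feasible
        ; no-worse  = ≤-reflexive (reflexive (≡.cong objective (≡.sym incumbent≡)))
        ; dominates = λ _ ()
        }

      Candidate : Seen
      Candidate Z′ = ∃ λ δ → ∃ λ u → ∃ λ v → Z′ ≡ candidate δ u v Z

      module _ {ρ′ : Sets n} (end : Scan Z O Candidate ρ′) where
        module E = Scan end
        best = incumbent ρ′

        moves-≤ : ∀ u v → Independent M ((whole Z ∖ v) ∪ ⁅ u ⁆) →
          objective (move u v Z) ≤ objective best × objective (move u v (mirror Z)) ≤ objective best
        moves-≤ u v i =
          E.dominates _ (leftward , u , v , ≡.refl) i ,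
          ≤-respˡ (objective-mirror (move u v (mirror Z))) (E.dominates _ (rightward , u , v , ≡.refl) i)

        advance : ∀ {X} → f O ≤ f X → 19 · f T ≤ 36 · f X ⊎ suc k · f T ≤ 2 · n · 2 · objective best
        advance {X} O≤X with potential | total (19 · f T) (36 · f O)
        ... | inj₁ good | _         = inj₁ (≤-trans good (·-monoʳ-≤ 36 O≤X))
        ... | inj₂ _    | inj₁ good = inj₁ (≤-trans good (·-monoʳ-≤ 36 O≤X))
        -- Twice `progress` is 20 f(T) + 4n g(Z) ≤ 36 f(W) + 4n g(best). With f(W) ≤ f(O) and 36
        -- f(O) ≤ 19 f(T), one f(T) remains on the left. The 19 is thus 20 less one unit of slack,
        -- 20/36 being 5/9.
        ... | inj₂ low  | inj₂ poor = inj₂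
          (linear-≤ (f T ∷ f (whole Z) ∷ f O ∷ n · 2 · objective Z ∷ n · 2 · objective best ∷ k · f T ∷ [])
            (2 ⊛ (10 ⊛ t₀ ⊹ nG) ⊹ 36 ⊛ w ⊹ 36 ⊛ o ⊹ kT) (2 ⊛ (18 ⊛ w ⊹ nB) ⊹ 36 ⊛ o ⊹ 19 ⊛ t₀ ⊹ 2 ⊛ nG)
            (t₀ ⊹ kT) (2 ⊛ nB) ≡.refl
            (+-mono-≤ (+-mono-≤ (+-mono-≤
              (·-monoʳ-≤ 2 (progress nonNegative monotone submodular M indep? Z T (objective best)
                 split feasible iT E.no-worse moves-≤))
              (·-monoʳ-≤ 36 output-≥)) poor) low))
          where
          t₀ w o nG nB kT : Linear 6
          t₀ = var 0F ; w = var 1F ; o = var 2F ; nG = var 3F ; nB = var 4F ; kT = var 5F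

        O≡ : output ρ′ ≡ O
        O≡ = E.output≡

        next : Sets n → Set
        next = Round (suc k)

        improved : Dec (f (output ρ′) ≤ f (whole best))
        improved = f (output ρ′) ≤? f (whole best)

        keep : ¬ (f (output ρ′) ≤ f (whole best)) →
          next (((ρ′ [ 1F ↦ ρ′ 7F ]) [ 2F ↦ ρ′ 8F ]) [ 3F ↦ ρ′ 9F ])
        keep worse = record
          { split           = E.split
          ; feasible        = E.feasible
          ; incumbent≡      = ≡.refl
          ; output-feasible = ≡.subst (Independent M) (≡.sym O≡) output-feasible
          ; output-≥        = [ (λ le → contradiction le worse) , id ]′
                                (total (f (output ρ′)) (f (whole best)))
          ; potential       = advance (≤-reflexive (reflexive (≡.cong f (≡.sym O≡))))
          }

        replace : f (output ρ′) ≤ f (whole best) →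
          next ((((ρ′ [ 1F ↦ ρ′ 7F ]) [ 2F ↦ ρ′ 8F ]) [ 3F ↦ ρ′ 9F ]) [ 0F ↦ ρ′ 9F ])
        replace le = record
          { split           = E.split
          ; feasible        = E.feasible
          ; incumbent≡      = ≡.refl
          ; output-feasible = E.feasible
          ; output-≥        = ≤-refl
          ; potential       = advance (≡.subst (λ X → f X ≤ f (whole best)) O≡ le)
          }

        after : wp _ _ (k ∷ []) next ρ′
        after = wp-seq (wp-copy 7F 1F (λ ()) (wp-seq (wp-copy 8F 2F (λ ()) (wp-seq (wp-copy 9F 3F (λ ())
          (wp-cond (does improved) (λ s h → ≡.cong₂ (λ X Y → does (f X ≤? f Y)) (rows h 0F) (rows h 3F))
            (λ eq → wp-copy 3F 0F (λ ()) (replace (does-true improved eq)))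
            (λ eq → wp-skip (keep (does-false improved eq)))))))))

    wp-algorithm : wp algorithm (algorithmTime n) [] (Round (28 ℕ.* n ℕ.+ 1)) (λ _ → ⊥)
    wp-algorithm = wp-for (λ _ → ≡.refl) Round (λ k ρ _ → wp-round k ρ) start
      where
      start : Round 0 (λ _ → ⊥)
      start = record
        { split           = record
          { left⊆whole  = id
          ; right⊆whole = id
          ; covered     = inj₁
          ; disjoint    = λ x∈⊥ _ → ∉⊥ x∈⊥
          }
        ; feasible        = Matroid.∅-independent M
        ; incumbent≡      = ≡.refl
        ; output-feasible = Matroid.∅-independent M
        ; output-≥        = ≤-refl
        ; potential       = inj₂ (·-nonNegative 2 (·-nonNegative n (·-nonNegative 2 (≤-respˡ
            (linear [] (nil ⊹ nil ⊹ nil) nil ≡.refl)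
            (+-mono-≤ (+-mono-≤ (·-nonNegative 2 (nonNegative ⊥)) (·-nonNegative 2 (nonNegative ⊥)))
              (·-nonNegative 3 (nonNegative ⊥)))))))
        }

    -- The second alternative of `potential` is not contradictory. It gives (28n + 1) f(T) ≤ 28n
    -- f(T), hence f(T) ≤ 0, and then the bound is trivial as f is nonnegative.
    final : ∀ {ρ} → (∀ S → Independent M S → f S ≤ f T) → Round (28 ℕ.* n ℕ.+ 1) ρ →
            19 · f T ≤ 36 · f (output ρ)
    final {ρ} optimal end with Round.potential end
    ... | inj₁ good = good
    ... | inj₂ high = ≤-trans (·-monoʳ-≤ 19 fT≤0) (≤-trans (≤-reflexive (·-zeroʳ 19))
                        (·-nonNegative 36 (nonNegative (output ρ))))
      where
      open Round end
      open Split split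
      Z = current ρ

      objective-≤ : 2 · objective Z ≤ 14 · f T
      objective-≤ = ≤-trans (·-monoʳ-≤ 2 (+-mono-≤ (+-mono-≤
          (·-monoʳ-≤ 2 (≤-trans (monotone left⊆whole) whole-≤))
          (·-monoʳ-≤ 2 (≤-trans (monotone right⊆whole) whole-≤)))
          (·-monoʳ-≤ 3 whole-≤)))
        (≤-reflexive (linear (f T ∷ []) (2 ⊛ (2 ⊛ var 0F ⊹ 2 ⊛ var 0F ⊹ 3 ⊛ var 0F)) (14 ⊛ var 0F) ≡.refl))
        where
        whole-≤ : f (whole Z) ≤ f T
        whole-≤ = optimal _ feasible

      2n14≡28n : 2 ℕ.* (n ℕ.* 14) ≡ 28 ℕ.* n
      2n14≡28n = solve 1 (λ m → con 2 :* (m :* con 14) := con 28 :* m) ≡.refl n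
        where open +-*-Solver

      fT≤0 : f T ≤ 0#
      fT≤0 = +-cancelʳ-≤ ((28 ℕ.* n) · f T)
        (≤-respˡ (trans (·-homo-+ (f T) (28 ℕ.* n) 1) (trans (+-comm _ _) (+-congʳ (+-identityʳ (f T)))))
          (≤-trans high (≤-trans (·-monoʳ-≤ 2 (·-monoʳ-≤ n objective-≤)) (≤-reflexive
            (trans (·-congʳ 2 (·-assoc (f T) n 14)) (trans (·-assoc (f T) 2 (n ℕ.* 14))
              (trans (reflexive (≡.cong (_· f T) 2n14≡28n)) (sym (+-identityˡ _)))))))))

-- Running time

infixl 6 _+ᴾ_
infixl 7 _*ᴾ_

_+ᴾ_ : Polynomial → Polynomial → Polynomial
[]      +ᴾ q       = q
(a ∷ p) +ᴾ []      = a ∷ p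
(a ∷ p) +ᴾ (b ∷ q) = a ℕ.+ b ∷ p +ᴾ q

_*ᴾ_ : ℕ → Polynomial → Polynomial
c *ᴾ p = map (c ℕ.*_) p

evalPoly-+ᴾ : ∀ p q n → evalPoly (p +ᴾ q) n ≡ evalPoly p n ℕ.+ evalPoly q n
evalPoly-+ᴾ []      q       n = ≡.refl
evalPoly-+ᴾ (a ∷ p) []      n = ≡.sym (ℕ.+-identityʳ _)
evalPoly-+ᴾ (a ∷ p) (b ∷ q) n rewrite evalPoly-+ᴾ p q n =
  solve 5 (λ a b n p q → a :+ b :+ n :* (p :+ q) := a :+ n :* p :+ (b :+ n :* q))
    ≡.refl a b n (evalPoly p n) (evalPoly q n)
  where open +-*-Solver

evalPoly-*ᴾ : ∀ c p n → evalPoly (c *ᴾ p) n ≡ c ℕ.* evalPoly p n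
evalPoly-*ᴾ c []      n = ≡.sym (ℕ.*-zeroʳ c)
evalPoly-*ᴾ c (a ∷ p) n rewrite evalPoly-*ᴾ c p n =
  solve 4 (λ c a n p → c :* a :+ n :* (c :* p) := c :* (a :+ n :* p))
    ≡.refl c a n (evalPoly p n)
  where open +-*-Solver

record IsPolynomial (t : ℕ → ℕ) : Set where
  field
    polynomial : Polynomial
    evaluates  : ∀ n → t n ≡ evalPoly polynomial n

open IsPolynomial

constant-polynomial : ∀ c → IsPolynomial (λ _ → c)
constant-polynomial c = record
  { polynomial = c ∷ []
  ; evaluates  = λ n → ≡.sym (≡.trans (≡.cong (c ℕ.+_) (ℕ.*-zeroʳ n)) (ℕ.+-identityʳ c))
  }

+-polynomial : ∀ {t u} → IsPolynomial t → IsPolynomial u → IsPolynomial (λ n → t n ℕ.+ u n)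
+-polynomial p q = record
  { polynomial = polynomial p +ᴾ polynomial q
  ; evaluates  = λ n → ≡.trans (≡.cong₂ ℕ._+_ (evaluates p n) (evaluates q n))
                               (≡.sym (evalPoly-+ᴾ (polynomial p) (polynomial q) n))
  }

*-polynomial : ∀ c {t} → IsPolynomial t → IsPolynomial (λ n → c ℕ.* t n)
*-polynomial c p = record
  { polynomial = c *ᴾ polynomial p
  ; evaluates  = λ n → ≡.trans (≡.cong (c ℕ.*_) (evaluates p n)) (≡.sym (evalPoly-*ᴾ c (polynomial p) n))
  }

size*-polynomial : ∀ {t} → IsPolynomial t → IsPolynomial (λ n → n ℕ.* t n)
size*-polynomial p = record
  { polynomial = 0 ∷ polynomial p
  ; evaluates  = λ n → ≡.cong (n ℕ.*_) (evaluates p n)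
  }

-- The only iteration counts are n and 28n + 1, so closure under multiplication by the count is a
-- parameter and replaces a general product of polynomials.
for-polynomial : ∀ bound (k : ℕ → ℕ) {t} → (∀ {u} → IsPolynomial u → IsPolynomial (λ n → k n ℕ.* u n)) →
                 IsPolynomial t → IsPolynomial (λ n → forTime bound (k n) (t n))
for-polynomial bound k k* p = +-polynomial
  (k* (+-polynomial (constant-polynomial (15 ℕ.+ costᴺ bound)) p))
  (constant-polynomial (11 ℕ.+ costᴺ bound))

copyTime-polynomial : IsPolynomial copyTime
copyTime-polynomial = for-polynomial size id size*-polynomial (constant-polynomial 10)

buildTime-polynomial : IsPolynomial buildTime
buildTime-polynomial = +-polynomial copyTime-polynomial (+-polynomial copyTime-polynomial
  (+-polynomial copyTime-polynomial (constant-polynomial 36)))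

tryTime-polynomial : IsPolynomial tryTime
tryTime-polynomial = +-polynomial buildTime-polynomial
  (+-polynomial (constant-polynomial (suc (costᵀ better)))
    (+-polynomial
      (+-polynomial copyTime-polynomial (+-polynomial copyTime-polynomial copyTime-polynomial))
      (constant-polynomial 1)))

scanTime-polynomial : IsPolynomial scanTime
scanTime-polynomial = for-polynomial size id size*-polynomial
  (for-polynomial size id size*-polynomial (+-polynomial tryTime-polynomial tryTime-polynomial))

roundTime-polynomial : IsPolynomial roundTime
roundTime-polynomial = +-polynomial scanTime-polynomial (+-polynomial copyTime-polynomial
  (+-polynomial copyTime-polynomial (+-polynomial copyTime-polynomial
    (+-polynomial (constant-polynomial 6) (+-polynomial copyTime-polynomial (constant-polynomial 1))))))

algorithmTime-polynomial : IsPolynomial algorithmTime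
algorithmTime-polynomial =
  for-polynomial rounds (λ n → 28 ℕ.* n ℕ.+ 1) rounds*-polynomial roundTime-polynomial
  where
  rounds*-polynomial : ∀ {t} → IsPolynomial t → IsPolynomial (λ n → (28 ℕ.* n ℕ.+ 1) ℕ.* t n)
  rounds*-polynomial {t} p = record
    { polynomial = polynomial q
    ; evaluates  = λ n → ≡.trans (expand n (t n)) (evaluates q n)
    }
    where
    q = +-polynomial (*-polynomial 28 (size*-polynomial p)) p
    expand : ∀ n t → (28 ℕ.* n ℕ.+ 1) ℕ.* t ≡ 28 ℕ.* (n ℕ.* t) ℕ.+ t
    expand = solve 2 (λ n t → (con 28 :* n :+ con 1) :* t := con 28 :* (n :* t) :+ t) ≡.refl
      where open +-*-Solver

-- The approximation guarantee

module Conclusion (ℝ : RealNumbers) {n} (f : SetFunction ℝ n)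
                  (nonNegative : NonNegative ℝ f) (monotone : Monotone ℝ f)
                  (submodular : Submodular ℝ f)
                  (M : Matroid n) (indep? : Decidable (Independent M)) where
  open OrderedField ℝ
  open Execution ℝ f indep?
  open Logic ℝ f indep? using (Holds; holds)
  open Correctness ℝ f nonNegative monotone submodular M indep? using (Round; wp-algorithm; final)

  empty-holds : Holds (λ _ → ⊥) [] (initial ℝ)
  empty-holds = holds (λ _ → lookup-injective λ i →
    ≡.trans (lookup∘tabulate (λ _ → false) i) (≡.sym (lookup-replicate i false))) tt

  Approximation : Set
  Approximation = ∃ λ I → ∃ λ t → algorithm Outputs I InTime t ×
    t ℕ.≤ evalPoly (polynomial algorithmTime-polynomial) n × Independent M I ×
    ∃ λ opt → IsMaximumOver ℝ f (Independent M) opt × 19 · opt ≤ 36 · f I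

  finish : ∀ T (iT : Independent M T) → (∀ S → Independent M S → f S ≤ f T) →
    (∃ λ s → ∃ λ t → ∃ λ ρ → initial ℝ ⊢ algorithm ⇓[ t ] s × t ℕ.≤ algorithmTime n ×
                             Holds ρ [] s × Round T iT (28 ℕ.* n ℕ.+ 1) ρ) → Approximation
  finish T iT max (s , t , ρ , run , le , h , end) =
    output ρ , t , (s , run , Holds.rows h 0F) ,
    ℕ.≤-trans le (ℕ.≤-reflexive (evaluates algorithmTime-polynomial n)) ,
    Round.output-feasible end , f T , ((T , iT , refl) , max) , final T iT max end

  approximation : Approximation
  approximation = [ (λ none → contradiction (Matroid.∅-independent M) (none ⊥)) , optimise ]′
    (Maximum.find-maximum ℝ f indep?)
    where
    optimise : (∃ λ T → Independent M T × (∀ S → Independent M S → f S ≤ f T)) → Approximation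
    optimise (T , iT , max) = finish T iT max (wp-algorithm T iT (initial ℝ) empty-holds)

theorem1 : (ℝ : RealNumbers) → let open RealNumbers ℝ in
    ∃ λ (algorithm : Program) → ∃ λ (poly : Polynomial) →
    ∀ (n : ℕ) (f : SetFunction ℝ n) →
    NonNegative ℝ f → Monotone ℝ f → Submodular ℝ f →
    ∀ (M : Matroid n) (indep? : Decidable (Independent M)) →
    let open Execution ℝ f indep? using (_Outputs_InTime_) in
    ∃ λ (I : Subset n) → ∃ λ (t : ℕ) →
    algorithm Outputs I InTime t ×
    t ℕ.≤ evalPoly poly n ×
    Independent M I ×
    ∃ λ opt → IsMaximumOver ℝ f (Independent M) opt ×
    (fromℕ 5008 ÷ fromℕ 10000) * opt ≤ f I
theorem1 ℝ = algorithm , polynomial algorithmTime-polynomial ,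
  λ n f nonNegative monotone submodular M indep? →
  let open OrderedField ℝ
      I , t , run , t≤ , feasible , opt , maximum , ratio =
        Conclusion.approximation ℝ f nonNegative monotone submodular M indep?
      0≤opt = ≤-respʳ (proj₂ (proj₂ (proj₁ maximum))) (nonNegative (proj₁ (proj₁ maximum)))
  in I , t , run , t≤ , feasible , opt , maximum ,
     -- The denominators 10000 and 36 are passed as their predecessors.
     ÷-*-≤ 5008 9999 (ratio-≤ 5008 9999 19 35 (toWitness {a? = 5008 ℕ.* 36 ℕ.≤? 10000 ℕ.* 19} tt) 0≤opt ratio)
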